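{- If $T$ is a twin-free tree on $n\geq 4$ vertices with $\gamma_t^{\mathrm{ID}}(T)=3n/4$, then $T$ is the $3$-corona of some tree $H$.
   Context: A graph is twin-free if it has no two distinct vertices $u,v$ with $N(u)=N(v)$ and no two distinct vertices with $N[u]=N[v]$. For $C\subseteq V(G)$, $I(v)=N[v]\cap C$. A total dominating identifying code is a set $C$ with $I(u)\neq I(v)$ for all distinct vertices $u,v$ and such that every vertex has a neighbour in $C$; $\gamma_t^{\mathrm{ID}}(G)$ is its minimum size. The $3$-corona of a graph $H$ is the graph of order $4|V(H)|$ obtained from $H$ by adding, for each vertex $v$ of $H$, a vertex-disjoint copy of the path $P_3$ and an edge joining $v$ to one end of that path. -}

module Defs where

open import Data.Nat using (ℕ; _≤_; _+_; _*_)
open import Data.Fin using (Fin; zero; suc; _≟_)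
open import Data.Fin.Subset using (Subset; _∈_; _∩_; ∣_∣)
open import Data.Bool using (Bool; true; false; _∨_; _∧_)
open import Data.Vec using (tabulate)
open import Data.List using (List; []; _∷_; _++_; length)
open import Data.List.Relation.Unary.Linked using (Linked)
open import Data.List.Relation.Unary.Unique.Propositional using (Unique)
open import Data.Product using (Σ; _×_; _,_; proj₁; proj₂)
open import Function.Bundles using (_⤖_; Bijection)
open import Relation.Binary.PropositionalEquality using (_≡_; _≢_)
open import Relation.Nullary using (¬_)
open import Relation.Nullary.Decidable using (⌊_⌋)

record Graph (n : ℕ) : Set where
  field
    adj    : Fin n → Fin n → Bool
    sym    : ∀ u v → adj u v ≡ adj v u
    irrefl : ∀ v → adj v v ≡ false
open Graph public

Adj : ∀ {n} → Graph n → Fin n → Fin n → Set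
Adj G u v = adj G u v ≡ true

data Reach {n : ℕ} (G : Graph n) : Fin n → Fin n → Set where
  here : ∀ {u} → Reach G u u
  step : ∀ {u w v} → Adj G u w → Reach G w v → Reach G u v

Connected : ∀ {n} → Graph n → Set
Connected G = ∀ u v → Reach G u v

IsCycle : ∀ {n} → Graph n → Fin n → List (Fin n) → Set
IsCycle G x xs = 2 ≤ length xs × Unique (x ∷ xs)
               × Linked (Adj G) (x ∷ xs ++ (x ∷ []))

Acyclic : ∀ {n} → Graph n → Set
Acyclic G = ∀ x xs → ¬ IsCycle G x xs

IsTree : ∀ {n} → Graph n → Set
IsTree G = Connected G × Acyclic G

N[_]⟨_⟩ : ∀ {n} → Graph n → Fin n → Subset n
N[ G ]⟨ v ⟩ = tabulate (λ w → adj G v w)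

N[_][_] : ∀ {n} → Graph n → Fin n → Subset n
N[ G ][ v ] = tabulate (λ w → ⌊ w ≟ v ⌋ ∨ adj G v w)

TwinFree : ∀ {n} → Graph n → Set
TwinFree G = ∀ u v → u ≢ v → (N[ G ]⟨ u ⟩ ≢ N[ G ]⟨ v ⟩) × (N[ G ][ u ] ≢ N[ G ][ v ])

I : ∀ {n} → Graph n → Subset n → Fin n → Subset n
I G C v = N[ G ][ v ] ∩ C

IsTDIDCode : ∀ {n} → Graph n → Subset n → Set
IsTDIDCode G C = (∀ u v → u ≢ v → I G C u ≢ I G C v)
               × (∀ v → Σ (Fin _) λ w → Adj G v w × w ∈ C)

γtID≡ : ∀ {n} → Graph n → ℕ → Set
γtID≡ G k = Σ (Subset _) (λ C → IsTDIDCode G C × ∣ C ∣ ≡ k)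
          × (∀ C → IsTDIDCode G C → k ≤ ∣ C ∣)

-- Adjacency inside the attached path: 1–2, 2–3 (and the edge 0–1
-- joining the vertex of H to one end of the path).
pathAdj : Fin 4 → Fin 4 → Bool
pathAdj zero (suc zero) = true
pathAdj (suc zero) zero = true
pathAdj (suc zero) (suc (suc zero)) = true
pathAdj (suc (suc zero)) (suc zero) = true
pathAdj (suc (suc zero)) (suc (suc (suc zero))) = true
pathAdj (suc (suc (suc zero))) (suc (suc zero)) = true
pathAdj _ _ = false

-- Adjacency of the 3-corona of H on vertex set Fin m × Fin 4:
-- (a , 0) is the vertex a of H, (a , 1)-(a , 2)-(a , 3) is its P₃.
coronaAdj : ∀ {m} → Graph m → Fin m × Fin 4 → Fin m × Fin 4 → Bool
coronaAdj H (a , zero) (b , zero) = adj H a b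
coronaAdj H (a , i) (b , j) = ⌊ a ≟ b ⌋ ∧ pathAdj i j

Is3CoronaOf : ∀ {n m} → Graph n → Graph m → Set
Is3CoronaOf {n} {m} G H =
  Σ (Fin n ⤖ (Fin m × Fin 4)) λ f →
    ∀ u v → adj G u v ≡ coronaAdj H (Bijection.to f u) (Bijection.to f v)

{-# OPTIONS --safe #-}

-- In a tree, C is a total dominating identifying code as soon as every vertex outside C has a
-- neighbour in C, every component of C has at least three vertices, and no vertex of C is the only
-- C-neighbour of two vertices outside C. Root the tree at ρ. For each i, the vertices of depth
-- ≡ i (mod 4) become the complement of such a code once every vertex with a leaf child or
-- grandchild is traded for that leaf, and the four complements have at least n elements in total.
-- If γ = 3n/4, four such complements can never have more than n elements in total. Shifting the
-- depth classes separately in each branch at ρ would give such a gain if ρ had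
--   * a leaf neighbour and two other neighbours,
--   * a leaf at distance two, and either two further inner neighbours or a further neighbour with
--     a leaf at most two steps beyond it,
--   * two leaves at distance three, or
--   * two neighbours and no leaf within distance three.
-- Excluding these for every ρ leaves only 3-coronas (P₄ being the one with two adjacent supports).
module Submission where

open import Defs hiding (sym)
open import Defs using () renaming (sym to adj-sym)
open import Data.Bool using (Bool; true; false; not; if_then_else_; _∧_; _∨_)
open import Data.Bool.Properties using (¬-not; ∨-zeroʳ)
import Data.Bool as Bool
open import Data.Empty using (⊥; ⊥-elim)
open import Data.Fin using (Fin; zero; suc; _≟_)
open import Data.Fin.Patterns using (0F; 1F; 2F; 3F)
import Data.Fin.Properties as Fin
open import Data.Fin.Properties using (any?; all?)
open import Data.Fin.Subset using (Subset; ∣_∣) renaming (_∈_ to _∈ₛ_)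
open import Data.Fin.Subset.Properties using (x∈p∩q⁺; x∈p∩q⁻)
open import Data.List using (List; []; _∷_; _++_; length; map)
open import Data.List.Membership.Propositional using (_∈_)
import Data.List.Membership.DecPropositional as DecMembership
open import Data.List.Properties using (map-++; length-map)
open import Data.List.Relation.Unary.All using (All; []; _∷_)
open import Data.List.Relation.Unary.All.Properties using (¬Any⇒All¬)
open import Data.List.Relation.Unary.Any using (here; there)
open import Data.List.Relation.Unary.Linked using (Linked; [-]; _∷_)
import Data.List.Relation.Unary.Linked.Properties as Linked
open import Data.List.Relation.Unary.Unique.Propositional using (Unique; []; _∷_)
import Data.List.Relation.Unary.Unique.Propositional.Properties as Unique
open import Data.Nat using (ℕ; zero; suc; pred; _+_; _*_; _≤_; z≤n; s≤s)
open import Data.Nat.Properties hiding (_≟_)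
open import Data.Nat.Tactic.RingSolver using (solve-∀)
open import Data.Product using (Σ; ∃-syntax; _×_; _,_; proj₁; proj₂)
open import Data.Sum using (_⊎_; inj₁; inj₂; [_,_]′)
open import Data.Unit using (tt)
open import Data.Vec using (tabulate)
open import Data.Vec.Properties using (lookup∘tabulate; lookup⇒[]=; []=⇒lookup; tabulate-cong)
open import Function using (_∘_; id; case_of_; mk⤖)
open import Relation.Binary.PropositionalEquality
open import Relation.Nullary using (¬_; Dec; yes; no; contradiction)
open import Relation.Nullary.Decidable
  using (⌊_⌋; _×-dec_; _⊎-dec_; _→-dec_; ¬?; map′; decidable-stable;
         dec-true; dec-false; isYes≗does)
open import Algebra.Properties.CommutativeMonoid.Sum +-0-commutativeMonoid
  using (sum; ∑-distrib-+; ∑-comm; sum-cong-≗)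

private variable
  n : ℕ

-- Walks, simple paths and cycles.

module _ (G : Graph n) where

  Adj-sym : ∀ {u v} → Adj G u v → Adj G v u
  Adj-sym {u} {v} a = trans (adj-sym G v u) a

  Adj⇒≢ : ∀ {u v} → Adj G u v → u ≢ v
  Adj⇒≢ {u} a refl with trans (sym (irrefl G u)) a
  ... | ()

  Adj? : ∀ u v → Dec (Adj G u v)
  Adj? u v = adj G u v Bool.≟ true

  data Walk (Q : Fin n → Set) : Fin n → Fin n → Set where
    end  : ∀ {x} → Q x → Walk Q x x
    _∷_◂_ : ∀ {x y z} → Q x → Adj G x y → Walk Q y z → Walk Q x z

  walk-head : ∀ {Q x z} → Walk Q x z → Q x
  walk-head (end q)     = q
  walk-head (q ∷ _ ◂ _) = q

  walk-append : ∀ {Q x y z} → Walk Q x y → Walk Q y z → Walk Q x z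
  walk-append (end _)     w = w
  walk-append (q ∷ a ◂ v) w = q ∷ a ◂ walk-append v w

  walk-reverse : ∀ {Q x y z} → Walk Q x y → Walk Q x z → Walk Q y z
  walk-reverse (end _)     acc = acc
  walk-reverse (q ∷ a ◂ v) acc = walk-reverse v (walk-head v ∷ Adj-sym a ◂ acc)

  data IsPath : Fin n → Fin n → List (Fin n) → Set where
    [-] : ∀ {x} → IsPath x x (x ∷ [])
    _∷_ : ∀ {x y z xs} → Adj G x y → IsPath y z xs → IsPath x z (x ∷ xs)

  SimplePath : (Fin n → Set) → Fin n → Fin n → Set
  SimplePath Q x z = ∃[ xs ] IsPath x z xs × Unique xs × All Q xs

  suffix : ∀ {Q x y z xs} → x ∈ xs → IsPath y z xs → Unique xs → All Q xs → SimplePath Q x z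
  suffix (here refl) [-]     u       q       = _ , [-] , u , q
  suffix (here refl) (a ∷ p) u       q       = _ , a ∷ p , u , q
  suffix (there i)   (a ∷ p) (_ ∷ u) (_ ∷ q) = suffix i p u q

  -- Loop erasure: if the new head already lies on the simple path of the tail, that path is cut
  -- back to the part starting there.
  walk⇒simplePath : ∀ {Q x z} → Walk Q x z → SimplePath Q x z
  walk⇒simplePath (end q) = _ , [-] , [] ∷ [] , q ∷ []
  walk⇒simplePath {x = x} (q ∷ a ◂ w) with walk⇒simplePath w
  ... | xs , p , u , qs with DecMembership._∈?_ _≟_ x xs
  ...   | yes x∈xs = suffix x∈xs p u qs
  ...   | no  x∉xs = x ∷ xs , a ∷ p , ¬Any⇒All¬ xs x∉xs ∷ u , q ∷ qs

  path-linked : ∀ {u v a b xs} → Adj G v a → IsPath a b xs → Adj G b u →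
                Linked (Adj G) (v ∷ xs ++ (u ∷ []))
  path-linked va [-]      bu = va ∷ bu ∷ [-]
  path-linked va (ax ∷ p) bu = va ∷ path-linked ax p bu

  path-length : ∀ {a b xs} → a ≢ b → IsPath a b xs → 2 ≤ length xs
  path-length a≢b [-]           = contradiction refl a≢b
  path-length a≢b (_ ∷ [-])     = s≤s (s≤s z≤n)
  path-length a≢b (_ ∷ (_ ∷ _)) = s≤s (s≤s z≤n)

  module _ (acyclic : Acyclic G) where

    -- The walk shortens to a simple path that still avoids `u`, and `u` closes this path to a
    -- cycle.
    no-detour : ∀ {u a b} → Adj G u a → Adj G u b → a ≢ b → ¬ Walk (u ≢_) a b
    no-detour {u} ua ub a≢b w with walk⇒simplePath w
    ... | xs , p , uniq , u∉xs =
      acyclic u xs (path-length a≢b p , u∉xs ∷ uniq , path-linked ua p (Adj-sym ub))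

    no-triangle : ∀ {u v w} → Adj G u v → Adj G v w → ¬ Adj G u w
    no-triangle uv vw uw = no-detour uv uw (Adj⇒≢ vw)
      (Adj⇒≢ uv ∷ vw ◂ end (Adj⇒≢ uw))

    common-neighbour-unique : ∀ {u v x y} → u ≢ v →
      Adj G u x → Adj G v x → Adj G u y → Adj G v y → x ≡ y
    common-neighbour-unique {u} {v} {x} {y} u≢v ux vx uy vy with x ≟ y
    ... | yes x≡y = x≡y
    ... | no  x≢y = contradiction
      (Adj⇒≢ ux ∷ Adj-sym vx ◂ (u≢v ∷ vy ◂ end (Adj⇒≢ uy)))
      (no-detour ux uy x≢y)

-- Rooted trees, and rooting a tree by distance.

record Rooted (G : Graph n) (ρ : Fin n) : Set where
  field
    parent      : Fin n → Fin n
    depth       : Fin n → ℕ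
    -- With this convention a leaf next to the root charges the root twice, as parent and as
    -- grandparent.
    parent-root : parent ρ ≡ ρ
    depth-root  : depth ρ ≡ 0
    depth-step  : ∀ {v} → v ≢ ρ → depth v ≡ suc (depth (parent v))
    adj-parent  : ∀ {v} → v ≢ ρ → Adj G v (parent v)
    orient      : ∀ {u v} → Adj G u v → (u ≢ ρ × parent u ≡ v) ⊎ (v ≢ ρ × parent v ≡ u)

least : ∀ {P : ℕ → Set} → (∀ k → Dec (P k)) → ∀ k → P k →
        ∃[ m ] P m × (∀ j → P j → m ≤ j)
least P? zero    p = 0 , p , λ _ _ → z≤n
least {P} P? (suc k) p with P? 0
... | yes p₀ = 0 , p₀ , λ _ _ → z≤n
... | no ¬p₀ with least {P ∘ suc} (P? ∘ suc) k p
...   | m , q , minimal = suc m , q , λ where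
        zero    p₀ → contradiction p₀ ¬p₀
        (suc j) p′ → s≤s (minimal j p′)

module _ (G : Graph n) (tree : IsTree G) (ρ : Fin n) where

  private
    ReachIn : ℕ → Fin n → Set
    ReachIn zero    v = v ≡ ρ
    ReachIn (suc k) v = ∃[ w ] Adj G v w × ReachIn k w

    ReachIn? : ∀ k v → Dec (ReachIn k v)
    ReachIn? zero    v = v ≟ ρ
    ReachIn? (suc k) v = any? (λ w → Adj? G v w ×-dec ReachIn? k w)

    reach⇒ : ∀ {v} → Reach G v ρ → ∃[ k ] ReachIn k v
    reach⇒ here       = 0 , refl
    reach⇒ (step a r) = let k , q = reach⇒ r in suc k , _ , a , q

    distance : ∀ v → ∃[ m ] ReachIn m v × (∀ j → ReachIn j v → m ≤ j)
    distance v = let k , q = reach⇒ (proj₁ tree v ρ) in least (λ j → ReachIn? j v) k q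

    dist : Fin n → ℕ
    dist = proj₁ ∘ distance

    dist-root : dist ρ ≡ 0
    dist-root = n≤0⇒n≡0 (proj₂ (proj₂ (distance ρ)) 0 refl)

    closer : ∀ v → ∃[ w ] ((v ≡ ρ × w ≡ ρ) ⊎ (v ≢ ρ × Adj G v w × dist v ≡ suc (dist w)))
    closer v with v ≟ ρ | distance v in eq
    ... | yes v≡ρ | _ = ρ , inj₁ (v≡ρ , refl)
    ... | no  v≢ρ | zero , v≡ρ , _ = contradiction v≡ρ v≢ρ
    ... | no  v≢ρ | suc m , (w , a , q) , minimal =
      w , inj₂ (v≢ρ , a , ≤-antisym
        (minimal _ (w , a , proj₁ (proj₂ (distance w))))
        (s≤s (proj₂ (proj₂ (distance w)) m q)))

    up : Fin n → Fin n
    up = proj₁ ∘ closer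

    up-spec : ∀ {v} → v ≢ ρ → Adj G v (up v) × dist v ≡ suc (dist (up v))
    up-spec {v} v≢ρ with closer v
    ... | _ , inj₁ (v≡ρ , _) = contradiction v≡ρ v≢ρ
    ... | _ , inj₂ (_ , spec) = spec

    up-root : up ρ ≡ ρ
    up-root with closer ρ
    ... | _ , inj₁ (_ , q)  = q
    ... | _ , inj₂ (q , _) = contradiction refl q

    -- Each step towards `ρ` lowers the distance, so every vertex after `a` is strictly closer to
    -- `ρ` than `u` and differs from it.
    descend : ∀ {u} k a → dist a ≡ k → k ≤ dist u → u ≢ a → Walk G (u ≢_) a ρ
    descend k a eq k≤ u≢a with a ≟ ρ
    descend k a eq k≤ u≢a | yes refl = end u≢a
    descend zero a eq k≤ u≢a | no a≢ρ with trans (sym eq) (proj₂ (up-spec a≢ρ))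
    ... | ()
    descend {u} (suc k) a eq k≤ u≢a | no a≢ρ =
      u≢a ∷ proj₁ (up-spec a≢ρ) ◂
      descend k (up a) e (<⇒≤ k≤) λ where refl → <-irrefl (sym e) k≤
      where
      e : dist (up a) ≡ k
      e = cong pred (trans (sym (proj₂ (up-spec a≢ρ))) eq)

    -- A neighbour a of u at most as far from ρ as u is its parent: otherwise descending from a
    -- to ρ and climbing back to the parent of u avoids u and closes a cycle.
    lower-neighbour : ∀ {u a} → Adj G u a → dist a ≤ dist u → u ≢ ρ × up u ≡ a
    lower-neighbour {u} {a} ua a≤u = u≢ρ , up≡a
      where
      u≢ρ : u ≢ ρ
      u≢ρ refl with subst (dist a ≤_) dist-root a≤u | a ≟ ρ
      ... | _   | yes refl = Adj⇒≢ G ua refl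
      ... | a≤0 | no a≢ρ with trans (sym (n≤0⇒n≡0 a≤0)) (proj₂ (up-spec a≢ρ))
      ...   | ()
      up≡a : up u ≡ a
      up≡a with up u ≟ a
      ... | yes e = e
      ... | no up≢a = contradiction
        (walk-append G (descend {u} _ a refl a≤u (Adj⇒≢ G ua))
          (walk-reverse G below (end (walk-head G below))))
        (no-detour G (proj₂ tree) ua (proj₁ (up-spec u≢ρ)) (≢-sym up≢a))
        where
        below : Walk G (u ≢_) (up u) ρ
        below = descend {u} _ (up u) refl
                  (≤-trans (n≤1+n _) (≤-reflexive (sym (proj₂ (up-spec u≢ρ)))))
                  (Adj⇒≢ G (proj₁ (up-spec u≢ρ)))

  root-at : Rooted G ρ
  root-at = record
    { parent      = up
    ; depth       = dist
    ; parent-root = up-root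
    ; depth-root  = dist-root
    ; depth-step  = λ v≢ρ → proj₂ (up-spec v≢ρ)
    ; adj-parent  = λ v≢ρ → proj₁ (up-spec v≢ρ)
    ; orient      = λ {u} {v} a → case ≤-total (dist v) (dist u) of λ where
        (inj₁ v≤u) → inj₁ (lower-neighbour a v≤u)
        (inj₂ u≤v) → inj₂ (lower-neighbour (Adj-sym G a) u≤v)
    }

-- Residues modulo 4 and membership in the sets `I`.

next : Fin 4 → Fin 4
next 0F = 1F
next 1F = 2F
next 2F = 3F
next 3F = 0F

∈-tabulate⁺ : ∀ {f : Fin n → Bool} {v} → f v ≡ true → v ∈ₛ tabulate f
∈-tabulate⁺ {f = f} {v} e = lookup⇒[]= v (tabulate f) (trans (lookup∘tabulate f v) e)

∈-tabulate⁻ : ∀ {f : Fin n → Bool} {v} → v ∈ₛ tabulate f → f v ≡ true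
∈-tabulate⁻ {f = f} {v} i = trans (sym (lookup∘tabulate f v)) ([]=⇒lookup i)

module _ (G : Graph n) where

  ∈I⁺ : ∀ {C v w} → w ≡ v ⊎ Adj G v w → w ∈ₛ C → w ∈ₛ I G C v
  ∈I⁺ {C} {v} {w} c w∈C = x∈p∩q⁺ (∈-tabulate⁺ (close c) , w∈C)
    where
    close : w ≡ v ⊎ Adj G v w → ⌊ w ≟ v ⌋ ∨ adj G v w ≡ true
    close (inj₁ e) rewrite trans (isYes≗does (w ≟ v)) (dec-true (w ≟ v) e) = refl
    close (inj₂ a) rewrite a = ∨-zeroʳ _

  ∈I⁻ : ∀ {C v w} → w ∈ₛ I G C v → (w ≡ v ⊎ Adj G v w) × w ∈ₛ C
  ∈I⁻ {C} {v} {w} i with x∈p∩q⁻ _ C i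
  ... | j , w∈C with w ≟ v | ∈-tabulate⁻ j
  ...   | yes e | _ = inj₁ e , w∈C
  ...   | no  _ | a = inj₂ a , w∈C

-- Leaves, phases and layers of a rooted tree.

module _ {G : Graph n} {ρ : Fin n} (rooted : Rooted G ρ) where

  open Rooted rooted

  Child : Fin n → Fin n → Set
  Child u v = u ≢ ρ × parent u ≡ v

  Child? : ∀ u v → Dec (Child u v)
  Child? u v = ¬? (u ≟ ρ) ×-dec (parent u ≟ v)

  HasChild : Fin n → Set
  HasChild v = ∃[ u ] Child u v

  HasChild? : ∀ v → Dec (HasChild v)
  HasChild? v = any? (λ u → Child? u v)

  -- The root never counts as a leaf, even when its degree is one.
  Leaf : Fin n → Set
  Leaf v = v ≢ ρ × ¬ HasChild v

  Leaf? : ∀ v → Dec (Leaf v)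
  Leaf? v = ¬? (v ≟ ρ) ×-dec ¬? (HasChild? v)

  LeafChild : Fin n → Set
  LeafChild v = ∃[ u ] Child u v × Leaf u

  LeafChild? : ∀ v → Dec (LeafChild v)
  LeafChild? v = any? (λ u → Child? u v ×-dec Leaf? u)

  Near : Fin n → Set
  Near v = LeafChild v ⊎ (∃[ u ] Child u v × LeafChild u)

  Near? : ∀ v → Dec (Near v)
  Near? v = LeafChild? v ⊎-dec any? (λ u → Child? u v ×-dec LeafChild? u)

  child-adj : ∀ {u v} → Child u v → Adj G u v
  child-adj (u≢ρ , refl) = adj-parent u≢ρ

  child-depth : ∀ {u v} → Child u v → depth u ≡ suc (depth v)
  child-depth (u≢ρ , refl) = depth-step u≢ρ

  child-asym : ∀ {u v} → Child u v → ¬ Child v u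
  child-asym c d = <-irrefl refl (≤-trans (n≤1+n _)
    (≤-reflexive (sym (trans (child-depth c) (cong suc (child-depth d))))))

  nonroot-cases : ∀ {v} → v ≢ ρ → Leaf v ⊎ HasChild v
  nonroot-cases {v} v≢ρ with HasChild? v
  ... | yes h = inj₂ h
  ... | no ¬h = inj₁ (v≢ρ , ¬h)

  leaf-neighbour : ∀ {u x} → Leaf u → Adj G u x → x ≡ parent u
  leaf-neighbour (_ , ¬h) ux with orient ux
  ... | inj₁ (_ , e) = sym e
  ... | inj₂ c       = contradiction (_ , c) ¬h

  near⇒hasChild : ∀ {v} → Near v → HasChild v
  near⇒hasChild (inj₁ (u , c , _)) = u , c
  near⇒hasChild (inj₂ (u , c , _)) = u , c

  module Phase (base : Fin n → Fin 4) where

    -- The number is the depth and serves as fuel for the climb along `parent`. Phases start at the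
    -- children of the root; the value at the root itself is a placeholder, since a flag decides
    -- separately whether the root is outside the code.
    phaseAt : ℕ → Fin n → Fin 4
    phaseAt zero          v = 0F
    phaseAt (suc zero)    v = base v
    phaseAt (suc (suc k)) v = next (phaseAt (suc k) (parent v))

    phase : Fin n → Fin 4
    phase v = phaseAt (depth v) v

    phase-top : ∀ {v} → Child v ρ → phase v ≡ base v
    phase-top {v} c rewrite child-depth c | depth-root = refl

    phase-child : ∀ {u v} → v ≢ ρ → Child u v → phase u ≡ next (phase v)
    phase-child v≢ρ c@(_ , refl) rewrite child-depth c | depth-step v≢ρ = refl

  -- The complement of the code: one depth class modulo 4 (shifted separately in each branch at
  -- the root), except that a vertex with a leaf child or grandchild never enters it and a leaf
  -- leaves it only if it lies three levels below the class. The leaves in E always belong to it.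
  module Layer (base : Fin n → Fin 4) (R : Bool) {E : Fin n → Set} (E? : ∀ v → Dec (E v)) where

    open Phase base public

    Out : Fin n → Set
    Out v = (v ≡ ρ × R ≡ true)
          ⊎ (Leaf v × (phase v ≢ 3F ⊎ E v))
          ⊎ (v ≢ ρ × HasChild v × phase v ≡ 0F × ¬ Near v)

    Out? : ∀ v → Dec (Out v)
    Out? v = ((v ≟ ρ) ×-dec (R Bool.≟ true))
         ⊎-dec ((Leaf? v ×-dec (¬? (phase v ≟ 3F) ⊎-dec E? v))
         ⊎-dec (¬? (v ≟ ρ) ×-dec (HasChild? v ×-dec ((phase v ≟ 0F) ×-dec ¬? (Near? v)))))

    In : Fin n → Set
    In v = ¬ Out v

    code : Subset n
    code = tabulate (λ v → not ⌊ Out? v ⌋)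

    In⇒∈ : ∀ {v} → In v → v ∈ₛ code
    In⇒∈ {v} i = ∈-tabulate⁺ (cong not (trans (isYes≗does (Out? v)) (dec-false (Out? v) i)))

    -- For `v` in the code: its component of the code has at least three vertices.
    Big : Fin n → Set
    Big v = ∃[ a ] ∃[ b ] In a × In b × Adj G v a × b ≢ v × b ≢ a × (Adj G a b ⊎ Adj G v b)

    root-In : R ≡ false → In ρ
    root-In ¬r (inj₁ (_ , r)) = contradiction (trans (sym ¬r) r) λ ()
    root-In ¬r (inj₂ (inj₁ ((ρ≢ρ , _) , _))) = ρ≢ρ refl
    root-In ¬r (inj₂ (inj₂ (ρ≢ρ , _))) = ρ≢ρ refl

    phase-In : ∀ {v} → v ≢ ρ → HasChild v → phase v ≢ 0F → In v
    phase-In v≢ρ _ _  (inj₁ (v≡ρ , _))                = v≢ρ v≡ρ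
    phase-In _ h _    (inj₂ (inj₁ ((_ , ¬h) , _)))    = ¬h h
    phase-In _ _ ≢0   (inj₂ (inj₂ (_ , _ , ≡0 , _)))  = ≢0 ≡0

    near-In : ∀ {v} → v ≢ ρ → Near v → In v
    near-In v≢ρ _ (inj₁ (v≡ρ , _))               = v≢ρ v≡ρ
    near-In _ nr  (inj₂ (inj₁ ((_ , ¬h) , _)))   = ¬h (near⇒hasChild nr)
    near-In _ nr  (inj₂ (inj₂ (_ , _ , _ , ¬nr))) = ¬nr nr

    leaf-In : ∀ {v} → Leaf v → phase v ≡ 3F → ¬ E v → In v
    leaf-In (v≢ρ , _) _ _ (inj₁ (v≡ρ , _))                  = v≢ρ v≡ρ
    leaf-In _ ≡3 _    (inj₂ (inj₁ (_ , inj₁ ≢3)))           = ≢3 ≡3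
    leaf-In _ _ ¬e    (inj₂ (inj₁ (_ , inj₂ e)))            = ¬e e
    leaf-In (_ , ¬h) _ _ (inj₂ (inj₂ (_ , h , _)))          = ¬h h

    inner-Out : ∀ {v} → v ≢ ρ → HasChild v → phase v ≡ 0F → ¬ Near v → Out v
    inner-Out v≢ρ h ≡0 ¬nr = inj₂ (inj₂ (v≢ρ , h , ≡0 , ¬nr))

    -- What has to be checked around the root. An omitted root must behave like an inner vertex of
    -- phase 0F, except that a child may also have phase 0F with no leaf near it and then be omitted
    -- too; `root-one` supplies a code neighbour of the root. `shallow` keeps `E` away from the
    -- third level below any omitted vertex other than the root.
    record Conditions : Set where
      field
        shallow     : ∀ {v} → E v → depth v ≤ 3
        root-¬E     : R ≡ true → ∀ {v} → ¬ E v
        root-¬near  : R ≡ true → ¬ Near ρ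
        root-phases : R ≡ true → ∀ {x} → Child x ρ → base x ≡ 1F ⊎ (base x ≡ 0F × ¬ Near x)
        root-one    : R ≡ true → ∃[ x ] Child x ρ × base x ≡ 1F
        root-big    : R ≡ false → Big ρ

    -- Every layer satisfying the conditions has a valid code as its complement.

    module Validity (acyclic : Acyclic G) (twinFree : TwinFree G) (conditions : Conditions) where

      open Conditions conditions

      -- Lets the root and deeper omitted vertices be treated alike. Below a non-root `y`, three
      -- levels down means depth at least four, whereas leaves in `E` have depth at most three.
      child-of-Out : ∀ {y v} → Out y → Child v y →
        ¬ Near y × (phase v ≡ 1F ⊎ (phase v ≡ 0F × ¬ Near v)) ×
        (∀ {z} → E z → depth z ≢ 3 + depth y)
      child-of-Out (inj₁ (refl , r)) c rewrite phase-top c =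
        root-¬near r , root-phases r c , λ e → contradiction e (root-¬E r)
      child-of-Out (inj₂ (inj₁ ((_ , ¬h) , _))) c = contradiction (_ , c) ¬h
      child-of-Out {y} (inj₂ (inj₂ (y≢ρ , _ , ≡0 , ¬nr))) c =
        ¬nr , inj₁ (trans (phase-child y≢ρ c) (cong next ≡0)) ,
        λ {z} e dz → <-irrefl refl (≤-trans (s≤s (s≤s (s≤s (s≤s z≤n))))
          (≤-trans (≤-reflexive (sym (trans dz (cong (3 +_) (depth-step y≢ρ))))) (shallow e)))

      -- An omitted inner vertex has phase 0F and no leaf child, so its children are inner vertices
      -- of phase 1F.
      inner-child-In : ∀ {u k} → Out u → u ≢ ρ → Child k u → In k
      inner-child-In (inj₁ (u≡ρ , _)) u≢ρ _ = contradiction u≡ρ u≢ρ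
      inner-child-In (inj₂ (inj₁ ((_ , ¬h) , _))) _ c = contradiction (_ , c) ¬h
      inner-child-In (inj₂ (inj₂ (u≢ρ , _ , ≡0 , ¬nr))) _ c with nonroot-cases (proj₁ c)
      ... | inj₁ lf = contradiction (inj₁ (_ , c , lf)) ¬nr
      ... | inj₂ h  = phase-In (proj₁ c) h λ k≡0 →
        contradiction (trans (sym k≡0) (trans (phase-child u≢ρ c) (cong next ≡0))) λ ()

      -- Since `y` has no leaf child or grandchild, `v` has a child `k` and `k` a child `m`. The
      -- phases of `v`, `k`, `m` are 1F, 2F, 3F, so all three are in the code; if `m` is a leaf, it
      -- stays because its phase is 3F and its depth keeps it out of `E`.
      below-Out : ∀ {y v} → Out y → Child v y → In v → Big v
      below-Out {y} {v} oy c iv with child-of-Out oy c | nonroot-cases (proj₁ c)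
      ... | ¬nr , _ , _ | inj₁ lf = contradiction (inj₁ (_ , c , lf)) ¬nr
      ... | ¬nr , inj₂ (≡0 , ¬nrv) , _ | inj₂ h =
        contradiction (inner-Out (proj₁ c) h ≡0 ¬nrv) iv
      ... | ¬nr , inj₁ ≡1 , noE | inj₂ (k , ck) with nonroot-cases (proj₁ ck)
      ...   | inj₁ lf = contradiction (inj₂ (_ , c , _ , ck , lf)) ¬nr
      ...   | inj₂ (m , cm) =
        k , m , phase-In (proj₁ ck) (m , cm) (λ k≡0 → contradiction (trans (sym k≡0) k≡2) λ ()) ,
        m-In , Adj-sym G (child-adj ck) , m≢v , Adj⇒≢ G (child-adj cm) ,
        inj₁ (Adj-sym G (child-adj cm))
        where
        k≡2 : phase k ≡ 2F
        k≡2 = trans (phase-child (proj₁ c) ck) (cong next ≡1)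
        m≡3 : phase m ≡ 3F
        m≡3 = trans (phase-child (proj₁ ck) cm) (cong next k≡2)
        m≢v : m ≢ v
        m≢v refl = child-asym ck cm
        m-In : In m
        m-In with nonroot-cases (proj₁ cm)
        ... | inj₁ lf = leaf-In lf m≡3 λ e → noE e
          (trans (child-depth cm) (cong suc (trans (child-depth ck) (cong suc (child-depth c)))))
        ... | inj₂ h  = phase-In (proj₁ cm) h λ m≡0 → contradiction (trans (sym m≡0) m≡3) λ ()

      -- The three vertices are `v`, `y`, `a` in general, and `v`, `y`, `b` when `v` is `a`.
      big-adj : ∀ {v y} → Adj G v y → In v → In y → Big y → Big v
      big-adj {v} {y} vy iv iy (a , b , ia , ib , ya , b≢y , b≢a , s) with v ≟ a | s
      ... | no v≢a   | _       = y , a , iy , ia , vy , ≢-sym v≢a , ≢-sym (Adj⇒≢ G ya) , inj₁ ya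
      ... | yes refl | inj₁ ab = y , b , iy , ib , vy , b≢a , b≢y , inj₂ ab
      ... | yes refl | inj₂ yb = y , b , iy , ib , vy , b≢a , b≢y , inj₁ yb

      -- Climb inside the code until reaching the root or a child of an omitted vertex; `big-adj`
      -- carries the size back down.
      In⇒Big : ∀ {v} → In v → Big v
      In⇒Big {v} = go (depth v) refl
        where
        go : ∀ k {v} → depth v ≡ k → In v → Big v
        go k {v} e iv with v ≟ ρ
        ... | yes refl = root-big (¬-not λ r → iv (inj₁ (refl , r)))
        go zero {v} e iv | no v≢ρ = contradiction (trans (sym e) (depth-step v≢ρ)) λ ()
        go (suc k) {v} e iv | no v≢ρ with Out? (parent v)
        ... | yes o = below-Out o (v≢ρ , refl) iv
        ... | no  i = big-adj (adj-parent v≢ρ) iv i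
                        (go k (suc-injective (trans (sym (depth-step v≢ρ)) e)) i)

      -- An omitted root has the child from `root-one`, an omitted inner vertex any of its children,
      -- and an omitted leaf its parent, which has a leaf child and therefore cannot be omitted.
      dominated : ∀ v → ∃[ w ] Adj G v w × In w
      dominated v with Out? v
      ... | no i = let a , _ , ia , _ , va , _ = In⇒Big i in a , va , ia
      ... | yes (inj₁ (refl , r)) with root-one r
      ...   | x , c , ≡1 with nonroot-cases (proj₁ c)
      ...     | inj₁ lf = contradiction (inj₁ (_ , c , lf)) (root-¬near r)
      ...     | inj₂ h  = x , Adj-sym G (child-adj c) , phase-In (proj₁ c) h
        λ x≡0 → contradiction (trans (sym x≡0) (trans (phase-top c) ≡1)) λ ()
      dominated v | yes o@(inj₂ (inj₂ (v≢ρ , (k , c) , _))) =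
        k , Adj-sym G (child-adj c) , inner-child-In o v≢ρ c
      dominated v | yes (inj₂ (inj₁ (lf@(v≢ρ , _) , _))) = parent v , adj-parent v≢ρ , parent-In
        where
        near : Near (parent v)
        near = inj₁ (v , (v≢ρ , refl) , lf)
        parent-In : In (parent v)
        parent-In o = proj₁ (child-of-Out o (v≢ρ , refl)) near

      -- If `w` is the parent of an inner `u`, the children of `u` are further code neighbours, so
      -- `w` is not the only one.
      private-cases : ∀ {u w} → Out u → Adj G u w → (∀ {k} → In k → Adj G u k → k ≡ w) →
                      (Child u w × Leaf u) ⊎ Child w u
      private-cases {u} {w} o uw only with orient uw
      ... | inj₂ c = inj₂ c
      ... | inj₁ c with nonroot-cases (proj₁ c)
      ...   | inj₁ lf = inj₁ (c , lf)
      ...   | inj₂ (k , ck) with only (inner-child-In o (proj₁ c) ck) (Adj-sym G (child-adj ck))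
      ...     | refl = contradiction ck (child-asym c)

      leaf-twins : ∀ {u v w} → u ≢ v → Child u w → Leaf u → Child v w → ¬ Leaf v
      leaf-twins {u} {v} {w} u≢v (u≢ρ , pu) lu (v≢ρ , pv) lv =
        proj₁ (twinFree u v u≢v) (tabulate-cong same)
        where
        same : ∀ x → adj G u x ≡ adj G v x
        same x with adj G u x in ux | adj G v x in vx
        ... | true  | true  = refl
        ... | false | false = refl
        ... | true  | false = trans (sym (subst (Adj G v)
          (trans pv (trans (sym pu) (sym (leaf-neighbour lu ux)))) (adj-parent v≢ρ))) vx
        ... | false | true  = trans (sym ux) (subst (Adj G u)
          (trans pu (trans (sym pv) (sym (leaf-neighbour lv vx)))) (adj-parent u≢ρ))

      -- Two leaf children of `w` are twins; a leaf child of `w` is a leaf grandchild of an omitted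
      -- parent of `w`, which is not allowed; and `w` has only one parent.
      not-both-private : ∀ {u v w} → u ≢ v → Out u → Out v →
        (Child u w × Leaf u) ⊎ Child w u → ¬ ((Child v w × Leaf v) ⊎ Child w v)
      not-both-private u≢v ou ov (inj₁ (cu , lu)) (inj₁ (cv , lv)) = leaf-twins u≢v cu lu cv lv
      not-both-private u≢v ou ov (inj₁ (cu , lu)) (inj₂ cw) =
        proj₁ (child-of-Out ov cw) (inj₂ (_ , cw , _ , cu , lu))
      not-both-private u≢v ou ov (inj₂ cw) (inj₁ (cv , lv)) =
        proj₁ (child-of-Out ou cw) (inj₂ (_ , cw , _ , cv , lv))
      not-both-private u≢v ou ov (inj₂ (_ , wu)) (inj₂ (_ , wv)) = u≢v (trans (sym wu) wv)

      shared : ∀ {u v w} → I G code u ≡ I G code v → In w → w ≡ u ⊎ Adj G u w → w ≡ v ⊎ Adj G v w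
      shared I≡ iw c = proj₁ (∈I⁻ G (subst (_ ∈ₛ_) I≡ (∈I⁺ G c (In⇒∈ iw))))

      -- Equal sets make `u` and `v` adjacent. Without triangles `a` must be `v`, and then `b`,
      -- adjacent to `u` or `v` and lying in both sets, closes a triangle.
      separates-In : ∀ {u v} → u ≢ v → I G code u ≡ I G code v → ¬ In u
      separates-In {u} {v} u≢v I≡ iu with shared I≡ iu (inj₁ refl) | In⇒Big iu
      ... | inj₁ u≡v | _ = u≢v u≡v
      ... | inj₂ vu | a , b , ia , ib , ua , b≢u , b≢a , s with shared I≡ ia (inj₂ ua)
      ...   | inj₂ va = no-triangle G acyclic vu ua va
      ...   | inj₁ refl with s
      ...     | inj₂ ub with shared I≡ ib (inj₂ ub)
      ...       | inj₁ b≡v = b≢a b≡v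
      ...       | inj₂ vb  = no-triangle G acyclic vu ub vb
      separates-In {u} {v} u≢v I≡ iu | inj₂ vu | a , b , ia , ib , ua , b≢u , b≢a , s
        | inj₁ refl | inj₁ vb with shared (sym I≡) ib (inj₂ vb)
      ...       | inj₁ b≡u = b≢u b≡u
      ...       | inj₂ ub  = no-triangle G acyclic ua vb ub

      -- Another code neighbour of `u` would be a second common neighbour of `u` and `v`.
      private-to : ∀ {u v w} → u ≢ v → I G code u ≡ I G code v → Out v → Adj G u w → Adj G v w →
                   ∀ {k} → In k → Adj G u k → k ≡ w
      private-to u≢v I≡ ov uw vw ik uk with shared I≡ ik (inj₂ uk)
      ... | inj₁ refl = contradiction ov ik
      ... | inj₂ vk   = common-neighbour-unique G acyclic u≢v uk vk uw vw

      separates : ∀ u v → u ≢ v → I G code u ≢ I G code v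
      separates u v u≢v I≡ with Out? u | Out? v
      ... | no iu  | _      = separates-In u≢v I≡ iu
      ... | _      | no iv  = separates-In (≢-sym u≢v) (sym I≡) iv
      ... | yes ou | yes ov with dominated u
      ...   | w , uw , iw with shared I≡ iw (inj₂ uw)
      ...     | inj₁ refl = contradiction ov iw
      ...     | inj₂ vw   = not-both-private u≢v ou ov
        (private-cases ou uw (private-to u≢v I≡ ov uw vw))
        (private-cases ov vw (private-to (≢-sym u≢v) (sym I≡) ou vw uw))

      code-valid : IsTDIDCode G code
      code-valid = separates , λ v → let w , vw , iw = dominated v in w , vw , In⇒∈ iw

-- Indicators and finite sums.

ind : ∀ {P : Set} → Dec P → ℕ
ind (yes _) = 1
ind (no _)  = 0

ind-yes : ∀ {P : Set} (d : Dec P) → P → ind d ≡ 1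
ind-yes (yes _) _ = refl
ind-yes (no ¬p) p = contradiction p ¬p

ind-no : ∀ {P : Set} (d : Dec P) → ¬ P → ind d ≡ 0
ind-no (yes p) ¬p = contradiction p ¬p
ind-no (no _)  _  = refl

ind-mono : ∀ {P Q : Set} (d : Dec P) (e : Dec Q) → (P → Q) → ind d ≤ ind e
ind-mono (yes p) (yes _) _ = ≤-refl
ind-mono (yes p) (no ¬q) f = contradiction (f p) ¬q
ind-mono (no _)  _       _ = z≤n

ind-disjoint : ∀ {P Q : Set} (d : Dec P) (e : Dec Q) → (P → ¬ Q) → ind d + ind e ≤ 1
ind-disjoint (yes p) (yes q) f = contradiction q (f p)
ind-disjoint (yes p) (no _)  _ = ≤-refl
ind-disjoint (no _)  (yes _) _ = ≤-refl
ind-disjoint (no _)  (no _)  _ = z≤n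

sum-mono : {f g : Fin n → ℕ} → (∀ i → f i ≤ g i) → sum f ≤ sum g
sum-mono {zero}  _ = z≤n
sum-mono {suc n} h = +-mono-≤ (h zero) (sum-mono (h ∘ suc))

sum-const : ∀ n c → sum {n} (λ _ → c) ≡ n * c
sum-const zero    c = refl
sum-const (suc n) c = cong (c +_) (sum-const n c)

term≤sum : (f : Fin n → ℕ) → ∀ i → f i ≤ sum f
term≤sum f zero    = m≤m+n _ _
term≤sum f (suc i) = ≤-trans (term≤sum (f ∘ suc) i) (m≤n+m _ _)

two-terms≤sum : (f : Fin n → ℕ) → ∀ {i j} → i ≢ j → f i + f j ≤ sum f
two-terms≤sum f {zero}  {zero}  i≢j = contradiction refl i≢j
two-terms≤sum f {zero}  {suc j} i≢j = +-monoʳ-≤ (f zero) (term≤sum (f ∘ suc) j)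
two-terms≤sum f {suc i} {zero}  i≢j = ≤-trans (≤-reflexive (+-comm (f (suc i)) (f zero)))
  (+-monoʳ-≤ (f zero) (term≤sum (f ∘ suc) i))
two-terms≤sum f {suc i} {suc j} i≢j =
  ≤-trans (two-terms≤sum (f ∘ suc) (i≢j ∘ cong suc)) (m≤n+m _ _)

sum-zero : {f : Fin n → ℕ} → (∀ i → f i ≡ 0) → sum f ≡ 0
sum-zero {n} f≡0 = trans (sum-cong-≗ {n} f≡0) (trans (sum-const n 0) (*-zeroʳ n))

sum-ind-* : ∀ (a : Fin n) x → sum (λ v → ind (a ≟ v) * x) ≡ x
sum-ind-* {suc n} zero    x =
  trans (cong₂ _+_ (+-identityʳ x) (sum-zero {n} {λ _ → 0} λ _ → refl)) (+-identityʳ x)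
sum-ind-* {suc n} (suc a) x = trans (sum-cong-≗ {n} step′) (sum-ind-* a x)
  where
  step′ : ∀ v → ind (suc a ≟ suc v) * x ≡ ind (a ≟ v) * x
  step′ v with a ≟ v
  ... | yes _ = refl
  ... | no  _ = refl

sum-ind : ∀ (a : Fin n) → sum (λ v → ind (a ≟ v)) ≡ 1
sum-ind {n} a = trans (sum-cong-≗ {n} λ v → sym (*-identityʳ (ind (a ≟ v)))) (sum-ind-* a 1)

∣tabulate-not∣ : ∀ {P : Fin n → Set} (P? : ∀ v → Dec (P v)) →
                 ∣ tabulate (λ v → not ⌊ P? v ⌋) ∣ ≡ sum (λ v → ind (¬? (P? v)))
∣tabulate-not∣ {zero}  P? = refl
∣tabulate-not∣ {suc n} P? with P? zero
... | yes _ = ∣tabulate-not∣ (P? ∘ suc)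
... | no  _ = cong suc (∣tabulate-not∣ (P? ∘ suc))

previous : Fin 4 → Fin 4
previous 0F = 3F
previous 1F = 0F
previous 2F = 1F
previous 3F = 2F

next-previous : ∀ t → next (previous t) ≡ t
next-previous 0F = refl
next-previous 1F = refl
next-previous 2F = refl
next-previous 3F = refl

previous-next : ∀ t → previous (next t) ≡ t
previous-next 0F = refl
previous-next 1F = refl
previous-next 2F = refl
previous-next 3F = refl

ind-next : ∀ s t → ind (next s ≟ t) ≡ ind (s ≟ previous t)
ind-next s t with next s ≟ t
... | yes refl = sym (ind-yes (s ≟ previous (next s)) (sym (previous-next s)))
... | no  ≢t   = sym (ind-no (s ≟ previous t) λ s≡ → ≢t (trans (cong next s≡) (next-previous t)))

-- Charges of leaves.

module _ {G : Graph n} {ρ : Fin n} (rooted : Rooted G ρ) where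

  open Rooted rooted

  -- A leaf is left out of three codes instead of one, which pays for keeping its parent and its
  -- grandparent in all four of them.
  charge : Fin n → ℕ
  charge v = sum λ ℓ → ind (Leaf? rooted ℓ) * (ind (parent ℓ ≟ v) + ind (parent (parent ℓ) ≟ v))

  total-charge : sum charge ≡ sum (λ ℓ → ind (Leaf? rooted ℓ) * 2)
  total-charge = trans
    (∑-comm λ v ℓ → ind (Leaf? rooted ℓ) * (ind (parent ℓ ≟ v) + ind (parent (parent ℓ) ≟ v)))
    (sum-cong-≗ {n} per-leaf)
    where
    per-leaf : ∀ ℓ → sum (λ v → ind (Leaf? rooted ℓ) *
                 (ind (parent ℓ ≟ v) + ind (parent (parent ℓ) ≟ v))) ≡ ind (Leaf? rooted ℓ) * 2
    per-leaf ℓ with Leaf? rooted ℓ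
    ... | no _  = sum-zero {n} {λ _ → 0} λ _ → refl
    ... | yes _ = trans (sum-cong-≗ {n} λ v →
        *-identityˡ (ind (parent ℓ ≟ v) + ind (parent (parent ℓ) ≟ v)))
      (trans (∑-distrib-+ (λ v → ind (parent ℓ ≟ v)) _)
             (cong₂ _+_ (sum-ind (parent ℓ)) (sum-ind (parent (parent ℓ)))))

  leaf-charge : ∀ {ℓ} → Leaf rooted ℓ → ∀ v →
                ind (parent ℓ ≟ v) + ind (parent (parent ℓ) ≟ v) ≤ charge v
  leaf-charge {ℓ} lf v = ≤-trans (≤-reflexive (sym (trans
      (cong (_* (ind (parent ℓ ≟ v) + ind (parent (parent ℓ) ≟ v))) (ind-yes (Leaf? rooted ℓ) lf))
      (*-identityˡ _))))
    (term≤sum (λ ℓ → ind (Leaf? rooted ℓ) * (ind (parent ℓ ≟ v) + ind (parent (parent ℓ) ≟ v))) ℓ)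

  near-charge : ∀ {v} → Near rooted v → 1 ≤ charge v
  near-charge {v} (inj₁ (ℓ , (_ , e) , lf)) = ≤-trans
    (≤-trans (≤-reflexive (sym (ind-yes (parent ℓ ≟ v) e))) (m≤m+n _ _)) (leaf-charge lf v)
  near-charge {v} (inj₂ (u , (_ , e) , ℓ , (_ , refl) , lf)) = ≤-trans
    (≤-trans (≤-reflexive (sym (ind-yes (parent u ≟ v) e))) (m≤n+m _ _)) (leaf-charge lf v)

-- Counting over a family of four layers.

module _ {G : Graph n} (acyclic : Acyclic G) (twinFree : TwinFree G)
         {k} (minimum : ∀ C → IsTDIDCode G C → k ≤ ∣ C ∣) (4k≡3n : 4 * k ≡ 3 * n)
         {ρ} (rooted : Rooted G ρ) where

  open Rooted rooted

  module Family (base : Fin n → Fin 4 → Fin 4) (R : Fin 4 → Bool)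
                {E : Fin n → Set} (E? : ∀ v → Dec (E v)) where

    module L (i : Fin 4) = Layer rooted (λ x → base x i) (R i) E?

    private
      leaf# extra# inside# root# : Fin n → ℕ
      leaf# v   = ind (Leaf? rooted v)
      extra# v  = ind (Leaf? rooted v ×-dec E? v)
      inside# v = sum λ i → ind (¬? (L.Out? i v))
      root# v   = ind (ρ ≟ v)

      roots : ℕ
      roots = sum λ i → ind (R i Bool.≟ true)

    module _ (bijective : ∀ x t → sum (λ i → ind (base x i ≟ t)) ≡ 1) where

      -- From parent to child the phases in all four layers move by the same cyclic permutation
      -- `next`, so each value is still taken exactly once.
      phase-bijective : ∀ {v} → v ≢ ρ → ∀ t → sum (λ i → ind (L.phase i v ≟ t)) ≡ 1
      phase-bijective {v} = go (depth v) refl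
        where
        go : ∀ d {v} → depth v ≡ d → v ≢ ρ → ∀ t → sum (λ i → ind (L.phase i v ≟ t)) ≡ 1
        go d {v} e v≢ρ t with parent v ≟ ρ
        ... | yes top = trans
          (sum-cong-≗ λ i → cong (λ s → ind (s ≟ t)) (L.phase-top i (v≢ρ , top))) (bijective v t)
        go zero {v} e v≢ρ t | no _ = contradiction (trans (sym e) (depth-step v≢ρ)) λ ()
        go (suc d) {v} e v≢ρ t | no p≢ρ = trans
          (sum-cong-≗ λ i → trans
            (cong (λ s → ind (s ≟ t)) (L.phase-child i p≢ρ (v≢ρ , refl)))
            (ind-next (L.phase i (parent v)) t))
          (go d (suc-injective (trans (sym (depth-step v≢ρ)) e)) p≢ρ (previous t))

      -- A leaf outside `E` is in the code only where its phase is 3F, that is, in one layer; a leaf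
      -- in `E` is in no code.
      leaf-inside : ∀ {v} → Leaf rooted v → inside# v + extra# v ≤ 1
      leaf-inside {v} lf = case E? v of λ where
        (yes e) → subst (λ m → m + extra# v ≤ 1)
          (sym (sum-zero λ i → ind-no (¬? (L.Out? i v)) λ ¬o → ¬o (inj₂ (inj₁ (lf , inj₂ e)))))
          (ind-mono (Leaf? rooted v ×-dec E? v) (yes tt) λ _ → tt)
        (no ¬e) → ≤-trans (≤-reflexive (trans
            (cong (inside# v +_) (ind-no (Leaf? rooted v ×-dec E? v) λ (_ , e) → ¬e e))
            (+-identityʳ _)))
          (≤-trans
            (sum-mono λ i → ind-mono (¬? (L.Out? i v)) (L.phase i v ≟ 3F) λ ¬o →
              decidable-stable (L.phase i v ≟ 3F) λ ≢3 → ¬o (inj₂ (inj₁ (lf , inj₁ ≢3))))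
            (≤-reflexive (phase-bijective (proj₁ lf) 3F)))

      -- The layer where the phase is 0F omits `v`, unless a leaf is near; then the charge pays for
      -- the fourth code.
      inner-inside : ∀ {v} → v ≢ ρ → HasChild rooted v → inside# v + 1 ≤ 4 + charge rooted v
      inner-inside {v} v≢ρ h = case Near? rooted v of λ where
        (yes nr) → +-mono-≤
          (sum-mono {g = λ _ → 1} λ i → ind-mono (¬? (L.Out? i v)) (yes tt) λ _ → tt)
          (near-charge rooted nr)
        (no ¬nr) → ≤-trans (≤-reflexive (trans
            (cong (inside# v +_) (sym (phase-bijective v≢ρ 0F)))
            (sym (∑-distrib-+ (λ i → ind (¬? (L.Out? i v))) λ i → ind (L.phase i v ≟ 0F)))))
          (≤-trans
            (sum-mono {g = λ _ → 1} λ i → ind-disjoint (¬? (L.Out? i v)) (L.phase i v ≟ 0F)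
              λ ¬o ≡0 → ¬o (L.inner-Out i v≢ρ h ≡0 ¬nr))
            (m≤m+n 4 _))

      root-inside : inside# ρ + roots ≤ 4
      root-inside = ≤-trans
        (≤-reflexive (sym (∑-distrib-+ (λ i → ind (¬? (L.Out? i ρ))) λ i → ind (R i Bool.≟ true))))
        (sum-mono {g = λ _ → 1} λ i →
          ind-disjoint (¬? (L.Out? i ρ)) (R i Bool.≟ true) λ ¬o r → ¬o (inj₁ (refl , r)))

      -- Subtraction-free form of the bound: three codes per vertex, plus the charge, minus two for
      -- a leaf and one more for a leaf in `E`. The root may cost one extra, reduced by `roots` and
      -- its own charge. After summation the charges cancel the leaf terms, so only that one extra
      -- is left and a gain of two contradicts it.
      pointwise : ∀ v →
        inside# v + (1 + leaf# v * 2 + extra# v + root# v * (roots + charge rooted ρ)) ≤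
        4 + charge rooted v + root# v
      pointwise v with ρ ≟ v
      ... | yes refl
        rewrite ind-no (Leaf? rooted ρ) (λ (ρ≢ρ , _) → ρ≢ρ refl)
              | ind-no (Leaf? rooted ρ ×-dec E? ρ) (λ ((ρ≢ρ , _) , _) → ρ≢ρ refl) = begin
          inside# ρ + (1 + (roots + charge rooted ρ + 0))
            ≡⟨ rearrange (inside# ρ) roots (charge rooted ρ) ⟩
          (inside# ρ + roots) + (charge rooted ρ + 1)
            ≤⟨ +-monoˡ-≤ (charge rooted ρ + 1) root-inside ⟩
          4 + (charge rooted ρ + 1)
            ≡⟨ +-assoc 4 (charge rooted ρ) 1 ⟨
          4 + charge rooted ρ + 1 ∎
        where
        open ≤-Reasoning
        rearrange : ∀ a b c → a + (1 + (b + c + 0)) ≡ (a + b) + (c + 1)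
        rearrange = solve-∀
      ... | no ρ≢v with nonroot-cases rooted (≢-sym ρ≢v)
      ...   | inj₁ lf rewrite ind-yes (Leaf? rooted v) lf = begin
          inside# v + (3 + extra# v + 0) ≡⟨ rearrange (inside# v) (extra# v) ⟩
          3 + (inside# v + extra# v)     ≤⟨ +-monoʳ-≤ 3 (leaf-inside lf) ⟩
          4                              ≤⟨ m≤m+n 4 _ ⟩
          4 + charge rooted v                   ≡⟨ +-identityʳ _ ⟨
          4 + charge rooted v + 0               ∎
        where
        open ≤-Reasoning
        rearrange : ∀ a b → a + (3 + b + 0) ≡ 3 + (a + b)
        rearrange = solve-∀
      ...   | inj₂ h
        rewrite ind-no (Leaf? rooted v) (λ (_ , ¬h) → ¬h h)
              | ind-no (Leaf? rooted v ×-dec E? v) (λ ((_ , ¬h) , _) → ¬h h) =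
          ≤-trans (inner-inside (≢-sym ρ≢v) h) (≤-reflexive (sym (+-identityʳ _)))

      -- Otherwise the complements of the four codes have more than n elements in total, so one of
      -- the codes has fewer than k.
      no-gain : (∀ i → IsTDIDCode G (L.code i)) → ¬ 2 ≤ sum extra# + (roots + charge rooted ρ)
      no-gain valid gain = <-irrefl refl (begin-strict
        sum inside# + (n + Λ + 1)
          <⟨ +-monoʳ-< (sum inside#) (+-monoʳ-< (n + Λ) gain) ⟩
        sum inside# + (n + Λ + (sum extra# + Y))
          ≡⟨ cong (sum inside# +_) lhs ⟨
        sum inside# + sum (λ v → 1 + leaf# v * 2 + extra# v + root# v * Y)
          ≡⟨ ∑-distrib-+ inside# _ ⟨
        sum (λ v → inside# v + (1 + leaf# v * 2 + extra# v + root# v * Y))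
          ≤⟨ sum-mono pointwise ⟩
        sum (λ v → 4 + charge rooted v + root# v)
          ≡⟨ rhs ⟩
        n * 4 + Λ + 1
          ≡⟨ rearrange n Λ ⟩
        3 * n + (n + Λ + 1)
          ≡⟨ cong (_+ (n + Λ + 1)) 4k≡3n ⟨
        4 * k + (n + Λ + 1)
          ≤⟨ +-monoˡ-≤ (n + Λ + 1) 4k≤ ⟩
        sum inside# + (n + Λ + 1) ∎)
        where
        open ≤-Reasoning
        Y Λ : ℕ
        Y = roots + charge rooted ρ
        Λ = sum (λ v → leaf# v * 2)
        rearrange : ∀ a b → a * 4 + b + 1 ≡ 3 * a + (a + b + 1)
        rearrange = solve-∀
        lhs : sum (λ v → 1 + leaf# v * 2 + extra# v + root# v * Y) ≡ n + Λ + (sum extra# + Y)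
        lhs = trans (∑-distrib-+ (λ v → 1 + leaf# v * 2 + extra# v) _)
          (trans (cong₂ _+_
            (trans (∑-distrib-+ (λ v → 1 + leaf# v * 2) extra#)
              (cong (_+ sum extra#) (trans (∑-distrib-+ (λ _ → 1) (λ v → leaf# v * 2))
                (cong (_+ Λ) (trans (sum-const n 1) (*-identityʳ n))))))
            (sum-ind-* ρ Y))
          (+-assoc (n + Λ) (sum extra#) Y))
        rhs : sum (λ v → 4 + charge rooted v + root# v) ≡ n * 4 + Λ + 1
        rhs = trans (∑-distrib-+ (λ v → 4 + charge rooted v) root#)
          (cong₂ _+_
            (trans (∑-distrib-+ (λ _ → 4) (charge rooted))
              (cong₂ _+_ (sum-const n 4) (total-charge rooted)))
            (sum-ind ρ))
        4k≤ : 4 * k ≤ sum inside#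
        4k≤ = begin
          4 * k                                         ≡⟨ sum-const 4 k ⟨
          sum {4} (λ _ → k)                             ≤⟨ sum-mono (λ i → minimum _ (valid i)) ⟩
          sum (λ i → ∣ L.code i ∣)                      ≡⟨ sum-cong-≗ (∣tabulate-not∣ ∘ L.Out?) ⟩
          sum (λ i → sum (λ v → ind (¬? (L.Out? i v)))) ≡⟨ ∑-comm (λ i v → ind (¬? (L.Out? i v))) ⟩
          sum inside#                                   ∎

-- Leaf conditions stated without a root, and their translation.

module _ (G : Graph n) where

  Pendant : Fin n → Set
  Pendant v = ∃[ s ] Adj G v s × (∀ {w} → Adj G v w → w ≡ s)

  -- This and `NearBeyond` are `LeafChild` and `Near` of `w` once `ρ` is the parent of `w`.
  LeafBeyond : Fin n → Fin n → Set
  LeafBeyond ρ w = ∃[ r ] Adj G w r × r ≢ ρ × Pendant r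

  NearBeyond : Fin n → Fin n → Set
  NearBeyond ρ w = LeafBeyond ρ w ⊎ (∃[ s ] Adj G w s × s ≢ ρ × LeafBeyond w s)

module _ {G : Graph n} {ρ : Fin n} (rooted : Rooted G ρ) where

  open Rooted rooted

  child-of-root : ∀ {x} → Adj G ρ x → Child rooted x ρ
  child-of-root a with orient a
  ... | inj₁ (ρ≢ρ , _) = contradiction refl ρ≢ρ
  ... | inj₂ c         = c

  child-beyond : ∀ {x y z} → Child rooted y z → Adj G y x → x ≢ z → Child rooted x y
  child-beyond (_ , py) a x≢z with orient a
  ... | inj₁ (_ , e) = contradiction (trans (sym e) py) x≢z
  ... | inj₂ c       = c

  pendant⇒leaf : ∀ {v y} → Child rooted v y → Pendant G v → Leaf rooted v
  pendant⇒leaf c (s , _ , only) = proj₁ c , λ (k , ck) →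
    case trans (only (Adj-sym G (child-adj rooted ck))) (sym (only (child-adj rooted c))) of λ where
      refl → child-asym rooted c ck

  leaf⇒pendant : ∀ {v} → Leaf rooted v → Pendant G v
  leaf⇒pendant lf = _ , adj-parent (proj₁ lf) , leaf-neighbour rooted lf

  inner-hasChild : ∀ {v y} → Child rooted v y → ¬ Pendant G v → HasChild rooted v
  inner-hasChild c ¬p with nonroot-cases rooted (proj₁ c)
  ... | inj₁ lf = contradiction (leaf⇒pendant lf) ¬p
  ... | inj₂ h  = h

  leafBeyond⇒leafChild : ∀ {w y} → Child rooted w y → LeafBeyond G y w → LeafChild rooted w
  leafBeyond⇒leafChild c (r , wr , r≢y , pr) =
    let cr = child-beyond c wr r≢y in r , cr , pendant⇒leaf cr pr

  leafChild⇒leafBeyond : ∀ {w y} → Child rooted w y → LeafChild rooted w → LeafBeyond G y w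
  leafChild⇒leafBeyond c (r , cr , lf) =
    r , Adj-sym G (child-adj rooted cr) , (λ where refl → child-asym rooted c cr) , leaf⇒pendant lf

  nearBeyond⇒near : ∀ {w y} → Child rooted w y → NearBeyond G y w → Near rooted w
  nearBeyond⇒near c (inj₁ l) = inj₁ (leafBeyond⇒leafChild c l)
  nearBeyond⇒near c (inj₂ (s , ws , s≢y , l)) =
    let cs = child-beyond c ws s≢y in inj₂ (s , cs , leafBeyond⇒leafChild cs l)

  near⇒nearBeyond : ∀ {w y} → Child rooted w y → Near rooted w → NearBeyond G y w
  near⇒nearBeyond c (inj₁ l) = inj₁ (leafChild⇒leafBeyond c l)
  near⇒nearBeyond c (inj₂ (s , cs , l)) = inj₂
    (s , Adj-sym G (child-adj rooted cs) , (λ where refl → child-asym rooted c cs)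
       , leafChild⇒leafBeyond cs l)

-- Shifting the phases separately in the branches at the root.

opposite : Fin 4 → Fin 4
opposite = next ∘ next

mirror : Fin 4 → Fin 4
mirror 0F = 1F
mirror 1F = 0F
mirror 2F = 3F
mirror 3F = 2F

Bijective₄ : (Fin 4 → Fin 4) → Set
Bijective₄ f = ∀ t → sum (λ i → ind (f i ≟ t)) ≡ 1

id-bijective : Bijective₄ id
id-bijective 0F = refl
id-bijective 1F = refl
id-bijective 2F = refl
id-bijective 3F = refl

opposite-bijective : Bijective₄ opposite
opposite-bijective 0F = refl
opposite-bijective 1F = refl
opposite-bijective 2F = refl
opposite-bijective 3F = refl

mirror-bijective : Bijective₄ mirror
mirror-bijective 0F = refl
mirror-bijective 1F = refl
mirror-bijective 2F = refl
mirror-bijective 3F = refl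

-- With `opposite`, no layer gives phase 0F both to `x₀` and to another neighbour of the root. With
-- `mirror`, layers 0F and 1F pair phase 0F with 1F, and in layers 2F and 3F no neighbour of the
-- root has phase 0F.
shift : Fin n → (Fin 4 → Fin 4) → Fin n → Fin 4 → Fin 4
shift x₀ g x i = if ⌊ x ≟ x₀ ⌋ then i else g i

shift-self : ∀ (x₀ : Fin n) g i → shift x₀ g x₀ i ≡ i
shift-self x₀ g i with x₀ ≟ x₀
... | yes _    = refl
... | no x₀≢x₀ = contradiction refl x₀≢x₀

shift-other : ∀ {x₀ x : Fin n} g i → x ≢ x₀ → shift x₀ g x i ≡ g i
shift-other {x₀ = x₀} {x} g i x≢x₀ with x ≟ x₀
... | yes x≡x₀ = contradiction x≡x₀ x≢x₀
... | no _     = refl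

shift-bijective : ∀ (x₀ : Fin n) {g} → Bijective₄ g → ∀ x → Bijective₄ (shift x₀ g x)
shift-bijective x₀ bij x with x ≟ x₀
... | yes _ = id-bijective
... | no  _ = bij

-- Configurations excluded around a vertex.

module _ {G : Graph n} (tree : IsTree G) (twinFree : TwinFree G)
         {k} (minimum : ∀ C → IsTDIDCode G C → k ≤ ∣ C ∣) (4k≡3n : 4 * k ≡ 3 * n) where

  module RootInside (ρ x₀ : Fin n) {E : Fin n → Set} (E? : ∀ v → Dec (E v)) where

    rooted : Rooted G ρ
    rooted = root-at G tree ρ

    open Rooted rooted public

    module F = Family (proj₂ tree) twinFree minimum 4k≡3n rooted
                      (shift x₀ opposite) (λ _ → false) E?

    -- The root is in all four codes here, so the gain consists of the leaves in `E` and the charge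
    -- of the root.
    contradict : (∀ {v} → E v → depth v ≤ 3) → (∀ i → F.L.Big i ρ) →
                 ¬ 2 ≤ sum (λ v → ind (Leaf? rooted v ×-dec E? v))
                         + charge rooted ρ
    contradict shallow big = F.no-gain (shift-bijective x₀ {opposite} opposite-bijective) λ i →
      F.L.Validity.code-valid i (proj₂ tree) twinFree record
        { shallow     = shallow
        ; root-¬E     = λ ()
        ; root-¬near  = λ ()
        ; root-phases = λ ()
        ; root-one    = λ ()
        ; root-big    = λ _ → big i
        }

    big-pair : ∀ i {x y} → x ≢ y → Adj G ρ x → Adj G ρ y → F.L.In i x → F.L.In i y → F.L.Big i ρ
    big-pair i x≢y ρx ρy ix iy =
      _ , _ , ix , iy , ρx , ≢-sym (Adj⇒≢ G ρy) , ≢-sym x≢y , inj₂ ρy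

    phase₀ : ∀ i → Adj G ρ x₀ → F.L.phase i x₀ ≡ i
    phase₀ i a = trans (F.L.phase-top i (child-of-root rooted a)) (shift-self x₀ opposite i)

    phase₁ : ∀ i {y} → x₀ ≢ y → Adj G ρ y → F.L.phase i y ≡ opposite i
    phase₁ i x₀≢y a = trans (F.L.phase-top i (child-of-root rooted a))
      (shift-other opposite i (≢-sym x₀≢y))

    inner-In : ∀ i {y t} → Adj G ρ y → ¬ Pendant G y → F.L.phase i y ≡ t → t ≢ 0F → F.L.In i y
    inner-In i ρy ¬p e t≢0 = let c = child-of-root rooted ρy in
      F.L.phase-In i (proj₁ c) (inner-hasChild rooted c ¬p) (t≢0 ∘ trans (sym e))

  -- Rooted at `ρ`, the leaf `r` charges the root twice, a gain of two. In layers 1F and 3F both `x`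
  -- and `y` are in the code; in the other two, one of them has phase 2F and joins the root together
  -- with a child of phase 3F.
  support-degree : ∀ {ρ r x y} → Adj G ρ r → Pendant G r → x ≢ y →
                   Adj G ρ x → ¬ Pendant G x → Adj G ρ y → ¬ ¬ Pendant G y
  support-degree {ρ} {r} {x} {y} ρr pr x≢y ρx ¬px ρy ¬py =
    contradict (λ ()) big (≤-trans charge≥2 (m≤n+m _ _))
    where
    open RootInside ρ x {λ _ → ⊥} (λ _ → no λ ())

    big-two : ∀ i {v} → Adj G ρ v → ¬ Pendant G v → F.L.phase i v ≡ 2F → F.L.Big i ρ
    big-two i {v} ρv ¬pv ≡2 with child-of-root rooted ρv
    ... | c with inner-hasChild rooted c ¬pv
    ...   | k , ck = v , k , inner-In i ρv ¬pv ≡2 (λ ()) , k-In , ρv , proj₁ ck ,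
                     Adj⇒≢ G (child-adj rooted ck) , inj₁ (Adj-sym G (child-adj rooted ck))
      where
      ≡3 : F.L.phase i k ≡ 3F
      ≡3 = trans (F.L.phase-child i (proj₁ c) ck) (cong next ≡2)
      k-In : F.L.In i k
      k-In with nonroot-cases rooted (proj₁ ck)
      ... | inj₁ lf = F.L.leaf-In i lf ≡3 λ ()
      ... | inj₂ h  = F.L.phase-In i (proj₁ ck) h λ ≡0 → contradiction (trans (sym ≡3) ≡0) λ ()

    big : ∀ i → F.L.Big i ρ
    big 0F = big-two 0F ρy ¬py (phase₁ 0F x≢y ρy)
    big 1F = big-pair 1F x≢y ρx ρy (inner-In 1F ρx ¬px (phase₀ 1F ρx) λ ())
                                   (inner-In 1F ρy ¬py (phase₁ 1F x≢y ρy) λ ())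
    big 2F = big-two 2F ρx ¬px (phase₀ 2F ρx)
    big 3F = big-pair 3F x≢y ρx ρy (inner-In 3F ρx ¬px (phase₀ 3F ρx) λ ())
                                   (inner-In 3F ρy ¬py (phase₁ 3F x≢y ρy) λ ())

    charge≥2 : 2 ≤ charge rooted ρ
    charge≥2 = let c = child-of-root rooted ρr in
      ≤-trans
        (≤-reflexive (sym (cong₂ _+_
          (ind-yes (parent r ≟ ρ) (proj₂ c))
          (ind-yes (parent (parent r) ≟ ρ) (trans (cong parent (proj₂ c)) parent-root)))))
        (leaf-charge rooted (pendant⇒leaf rooted c pr) ρ)

  module _ {ρ c} (ρc : Adj G ρ c) (leafBeyond : LeafBeyond G ρ c) where

    private
      r : Fin n
      r = proj₁ leafBeyond

      module M (x : Fin n) where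
        open RootInside ρ x {_≡ r} (_≟ r) public

        cc : Child rooted c ρ
        cc = child-of-root rooted ρc

        cr : Child rooted r c
        cr = child-beyond rooted cc (proj₁ (proj₂ leafBeyond)) (proj₁ (proj₂ (proj₂ leafBeyond)))

        lr : Leaf rooted r
        lr = pendant⇒leaf rooted cr (proj₂ (proj₂ (proj₂ leafBeyond)))

        -- The leaf `r` at distance two gains one by lying in `E` and one by charging the root as
        -- grandparent. Having a leaf child, `c` is in every code, so one more code neighbour of `ρ`
        -- per layer suffices.
        absurd : (∀ i → ∃[ z ] c ≢ z × Adj G ρ z × F.L.In i z) → ⊥
        absurd third = contradict
          (λ where refl → ≤-trans (≤-reflexive (trans (child-depth rooted cr)
                            (cong suc (trans (child-depth rooted cc) (cong suc depth-root)))))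
                            (n≤1+n 2))
          (λ i → let z , c≢z , ρz , iz = third i in
            big-pair i c≢z ρc ρz (F.L.near-In i (proj₁ cc) (inj₁ (r , cr , lr))) iz)
          (+-mono-≤ {1}
            (≤-trans (≤-reflexive (sym (ind-yes (Leaf? rooted r ×-dec (r ≟ r)) (lr , refl))))
              (term≤sum (λ v → ind (Leaf? rooted v ×-dec (v ≟ r))) r))
            (near-charge rooted (inj₂ (c , cc , r , cr , lr))))

    -- With a leaf so close below it, `z` is in all four codes.
    not-near-beside : ∀ {z} → Adj G ρ z → c ≢ z → ¬ NearBeyond G ρ z
    not-near-beside {z} ρz c≢z nb = absurd λ i → z , c≢z , ρz , F.L.near-In i (proj₁ cz)
        (nearBeyond⇒near rooted cz nb)
      where
      open M z
      cz : Child rooted z ρ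
      cz = child-of-root rooted ρz

    -- `x` has phase 0F only in layer 0F, and there `y` has phase 2F.
    no-two-inner-beside : ∀ {x y} → x ≢ y → c ≢ x → c ≢ y →
                          Adj G ρ x → ¬ Pendant G x → Adj G ρ y → ¬ ¬ Pendant G y
    no-two-inner-beside {x} {y} x≢y c≢x c≢y ρx ¬px ρy ¬py = absurd λ where
        0F → y , c≢y , ρy , inner-In 0F ρy ¬py (phase₁ 0F x≢y ρy) λ ()
        1F → x , c≢x , ρx , inner-In 1F ρx ¬px (phase₀ 1F ρx) λ ()
        2F → x , c≢x , ρx , inner-In 2F ρx ¬px (phase₀ 2F ρx) λ ()
        3F → x , c≢x , ρx , inner-In 3F ρx ¬px (phase₀ 3F ρx) λ ()
      where open M x

  record PendantPath (ρ w c r : Fin n) : Set where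
    field
      ρw  : Adj G ρ w
      wc  : Adj G w c
      c≢ρ : c ≢ ρ
      cr  : Adj G c r
      r≢w : r ≢ w
      pr  : Pendant G r

  -- Two distinct leaves at distance three can both be put into `E`, a gain of two. The root stays
  -- in a large component, since `w` and `c` have the leaf `r` near and lie in every code.
  pendantPath-unique : ∀ {ρ w c r w′ c′ r′} → PendantPath ρ w c r → PendantPath ρ w′ c′ r′ → r ≡ r′
  pendantPath-unique {ρ} {w} {c} {r} {w′} {c′} {r′} P P′ with r ≟ r′
  ... | yes e = e
  ... | no r≢r′ = ⊥-elim (contradict
      [ (λ where refl → shallow P) , (λ where refl → shallow P′) ]′ big
      (≤-trans (≤-trans
        (≤-reflexive (cong₂ _+_
          (sym (ind-yes (Leaf? rooted r ×-dec E? r) (leaf P , inj₁ refl)))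
          (sym (ind-yes (Leaf? rooted r′ ×-dec E? r′) (leaf P′ , inj₂ refl)))))
        (two-terms≤sum (λ v → ind (Leaf? rooted v ×-dec E? v)) r≢r′)) (m≤m+n _ _)))
    where
    E? : ∀ v → Dec (v ≡ r ⊎ v ≡ r′)
    E? v = (v ≟ r) ⊎-dec (v ≟ r′)

    -- No child of the root equals `ρ`, so all branches receive the same phases.
    open RootInside ρ ρ E?

    module Chain {w c r} (P : PendantPath ρ w c r) where
      open PendantPath P
      cw : Child rooted w ρ
      cw = child-of-root rooted ρw
      cc : Child rooted c w
      cc = child-beyond rooted cw wc c≢ρ
      cℓ : Child rooted r c
      cℓ = child-beyond rooted cc cr r≢w
      leaf : Leaf rooted r
      leaf = pendant⇒leaf rooted cℓ pr
      shallow : depth r ≤ 3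
      shallow = ≤-reflexive (trans (child-depth rooted cℓ) (cong suc
        (trans (child-depth rooted cc) (cong suc
          (trans (child-depth rooted cw) (cong suc depth-root))))))

    open Chain using (leaf; shallow)

    big : ∀ i → F.L.Big i ρ
    big i = w , c , F.L.near-In i (proj₁ cw) (inj₂ (c , cc , r , cℓ , leaf P))
                  , F.L.near-In i (proj₁ cc) (inj₁ (r , cℓ , leaf P))
                  , ρw , c≢ρ , ≢-sym (Adj⇒≢ G wc) , inj₁ wc
      where
      open PendantPath P
      open Chain P hiding (leaf; shallow)

  -- Here the root belongs to two of the four layers: one where the branch at x is cut at x, and one
  -- where all the other branches are cut at the root's neighbours.
  leaf-within-three : ∀ {ρ x y} → x ≢ y → Adj G ρ x → Adj G ρ y →
    (∀ {w} → Adj G ρ w → ¬ Pendant G w × ¬ NearBeyond G ρ w) → ⊥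
  leaf-within-three {ρ} {x} {y} x≢y ρx ρy far =
    F.no-gain (shift-bijective x {mirror} mirror-bijective)
      (λ i → F.L.Validity.code-valid i (proj₂ tree) twinFree (conditions i))
      (≤-trans (m≤m+n 2 _) (m≤n+m _ _))
    where
    rooted : Rooted G ρ
    rooted = root-at G tree ρ

    R : Fin 4 → Bool
    R 0F = true
    R 1F = true
    R 2F = false
    R 3F = false

    module F = Family (proj₂ tree) twinFree minimum 4k≡3n rooted
                      (shift x mirror) R {λ _ → ⊥} (λ _ → no λ ())

    down : ∀ {w} → Child rooted w ρ → Adj G ρ w
    down c = Adj-sym G (child-adj rooted c)

    ¬near : ∀ {w} → Child rooted w ρ → ¬ Near rooted w
    ¬near c nr = proj₂ (far (down c)) (near⇒nearBeyond rooted c nr)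

    root-¬near : ¬ Near rooted ρ
    root-¬near (inj₁ (w , c , lf))    = proj₁ (far (down c)) (leaf⇒pendant rooted lf)
    root-¬near (inj₂ (w , c , lc))    = ¬near c (inj₁ lc)

    base-x : ∀ i → shift x mirror x i ≡ i
    base-x = shift-self x mirror

    base-other : ∀ {w} i → w ≢ x → shift x mirror w i ≡ mirror i
    base-other = shift-other mirror

    root-phases : ∀ i → R i ≡ true → ∀ {w} → Child rooted w ρ →
      shift x mirror w i ≡ 1F ⊎ (shift x mirror w i ≡ 0F × ¬ Near rooted w)
    root-phases 2F ()
    root-phases 3F ()
    root-phases 0F r {w} c with w ≟ x
    ... | yes _ = inj₂ (refl , ¬near c)
    ... | no  _ = inj₁ refl
    root-phases 1F r {w} c with w ≟ x
    ... | yes _ = inj₁ refl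
    ... | no  _ = inj₂ (refl , ¬near c)

    root-one : ∀ i → R i ≡ true → ∃[ w ] Child rooted w ρ × shift x mirror w i ≡ 1F
    root-one 2F ()
    root-one 3F ()
    root-one 0F _ = y , child-of-root rooted ρy , base-other 0F (≢-sym x≢y)
    root-one 1F _ = x , child-of-root rooted ρx , base-x 1F

    inner-In : ∀ i {w t} → Adj G ρ w → shift x mirror w i ≡ t → t ≢ 0F → F.L.In i w
    inner-In i ρw e t≢0 = let c = child-of-root rooted ρw in
      F.L.phase-In i (proj₁ c) (inner-hasChild rooted c (proj₁ (far ρw)))
        (t≢0 ∘ trans (trans (sym e) (sym (F.L.phase-top i c))))

    root-big : ∀ i → R i ≡ false → F.L.Big i ρ
    root-big i r = x , y , inner-In i ρx (base-x i) (i≢0 r)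
      , inner-In i ρy (base-other i (≢-sym x≢y)) (m≢0 r)
      , ρx , ≢-sym (Adj⇒≢ G ρy) , ≢-sym x≢y , inj₂ ρy
      where
      i≢0 : ∀ {i} → R i ≡ false → i ≢ 0F
      i≢0 () refl
      m≢0 : ∀ {i} → R i ≡ false → mirror i ≢ 0F
      m≢0 {2F} _ ()
      m≢0 {3F} _ ()

    conditions : ∀ i → F.L.Conditions i
    conditions i = record
      { shallow     = λ ()
      ; root-¬E     = λ _ ()
      ; root-¬near  = λ _ → root-¬near
      ; root-phases = root-phases i
      ; root-one    = root-one i
      ; root-big    = root-big i
      }

-- Enumerating a decidable set of vertices.

bool-ext : ∀ {x y : Bool} → (x ≡ true → y ≡ true) → (y ≡ true → x ≡ true) → x ≡ y
bool-ext {true}  {true}  _ _ = refl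
bool-ext {true}  {false} f _ = sym (f refl)
bool-ext {false} {true}  _ g = g refl
bool-ext {false} {false} _ _ = refl

record Enumeration (P : Fin n → Set) : Set where
  field
    size      : ℕ
    elem      : Fin size → Fin n
    injective : ∀ {a b} → elem a ≡ elem b → a ≡ b
    sound     : ∀ a → P (elem a)
    index     : ∀ {v} → P v → ∃[ a ] elem a ≡ v

enumerate : {P : Fin n → Set} → (∀ v → Dec (P v)) → Enumeration P
enumerate {zero} P? = record
  { size      = 0
  ; elem      = λ ()
  ; injective = λ {a} → contradiction a Fin.¬Fin0
  ; sound     = λ ()
  ; index     = λ {v} → contradiction v Fin.¬Fin0
  }
enumerate {suc n} {P} P? with enumerate (P? ∘ suc) | P? zero
... | rest | no ¬p₀ = record
  { size      = size
  ; elem      = suc ∘ elem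
  ; injective = injective ∘ Fin.suc-injective
  ; sound     = sound
  ; index     = λ {v} → index′ v
  }
  where
  open Enumeration rest
  index′ : ∀ v → P v → ∃[ a ] suc (elem a) ≡ v
  index′ zero    p = contradiction p ¬p₀
  index′ (suc v) p = let a , e = index p in a , cong suc e
... | rest | yes p₀ = record
  { size      = suc size
  ; elem      = elem′
  ; injective = λ {a} {b} → injective′ a b
  ; sound     = sound′
  ; index     = λ {v} → index′ v
  }
  where
  open Enumeration rest
  elem′ : Fin (suc size) → Fin (suc n)
  elem′ zero    = zero
  elem′ (suc a) = suc (elem a)
  injective′ : ∀ a b → elem′ a ≡ elem′ b → a ≡ b
  injective′ zero    zero    _ = refl
  injective′ (suc a) (suc b) e = cong suc (injective (Fin.suc-injective e))
  sound′ : ∀ a → P (elem′ a)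
  sound′ zero    = p₀
  sound′ (suc a) = sound a
  index′ : ∀ v → P v → ∃[ a ] elem′ a ≡ v
  index′ zero    p = zero , refl
  index′ (suc v) p = let a , e = index p in suc a , cong suc e

-- Recognising a 3-corona from its arms.

pathAdj-sym : ∀ i j → pathAdj i j ≡ pathAdj j i
pathAdj-sym 0F 0F = refl
pathAdj-sym 0F 1F = refl
pathAdj-sym 0F 2F = refl
pathAdj-sym 0F 3F = refl
pathAdj-sym 1F 0F = refl
pathAdj-sym 1F 1F = refl
pathAdj-sym 1F 2F = refl
pathAdj-sym 1F 3F = refl
pathAdj-sym 2F 0F = refl
pathAdj-sym 2F 1F = refl
pathAdj-sym 2F 2F = refl
pathAdj-sym 2F 3F = refl
pathAdj-sym 3F 0F = refl
pathAdj-sym 3F 1F = refl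
pathAdj-sym 3F 2F = refl
pathAdj-sym 3F 3F = refl

-- The map `kind` separates the four positions, and injectivity is asked only of the hubs: the
-- `only` fields carry it along the arms.
record CoronaStructure (G : Graph n) : Set where
  field
    hubs          : ℕ
    arm           : Fin hubs → Fin 4 → Fin n
    kind          : Fin n → Fin 4
    kind-arm      : ∀ a i → kind (arm a i) ≡ i
    hub-injective : ∀ {a b} → arm a 0F ≡ arm b 0F → a ≡ b
    cover         : ∀ v → ∃[ a ] ∃[ i ] arm a i ≡ v
    edge₀₁        : ∀ a → Adj G (arm a 0F) (arm a 1F)
    edge₁₂        : ∀ a → Adj G (arm a 1F) (arm a 2F)
    edge₂₃        : ∀ a → Adj G (arm a 2F) (arm a 3F)
    only₁         : ∀ a {v} → Adj G (arm a 1F) v → v ≡ arm a 0F ⊎ v ≡ arm a 2F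
    only₂         : ∀ a {v} → Adj G (arm a 2F) v → v ≡ arm a 1F ⊎ v ≡ arm a 3F
    only₃         : ∀ a {v} → Adj G (arm a 3F) v → v ≡ arm a 2F

module _ {G : Graph n} (tree : IsTree G) (structure : CoronaStructure G) where

  open CoronaStructure structure

  hub : Fin hubs → Fin n
  hub a = arm a 0F

  hubGraph : Graph hubs
  hubGraph = record
    { adj    = λ a b → adj G (hub a) (hub b)
    ; sym    = λ a b → adj-sym G (hub a) (hub b)
    ; irrefl = λ a → irrefl G (hub a)
    }

  private
    H : Graph hubs
    H = hubGraph

  same-kind : ∀ {a b i j} → arm a i ≡ arm b j → i ≡ j
  same-kind {a} {b} {i} {j} e = trans (sym (kind-arm a i)) (trans (cong kind e) (kind-arm b j))

  -- The shared vertex has only one neighbour of kind 0F, so the two hubs coincide.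
  injective-at-1 : ∀ {a b} → arm a 1F ≡ arm b 1F → a ≡ b
  injective-at-1 {a} {b} e
    with only₁ a (subst (λ x → Adj G x (arm b 0F)) (sym e) (Adj-sym G (edge₀₁ b)))
  ... | inj₁ e₀ = hub-injective (sym e₀)
  ... | inj₂ e₂ = contradiction (same-kind e₂) λ ()

  injective-at-2 : ∀ {a b} → arm a 2F ≡ arm b 2F → a ≡ b
  injective-at-2 {a} {b} e
    with only₂ a (subst (λ x → Adj G x (arm b 1F)) (sym e) (Adj-sym G (edge₁₂ b)))
  ... | inj₁ e₁ = injective-at-1 (sym e₁)
  ... | inj₂ e₃ = contradiction (same-kind e₃) λ ()

  injective-at : ∀ {a b} i → arm a i ≡ arm b i → a ≡ b
  injective-at 0F e = hub-injective e
  injective-at 1F e = injective-at-1 e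
  injective-at 2F e = injective-at-2 e
  injective-at {a} {b} 3F e = injective-at-2
    (sym (only₃ a (subst (λ x → Adj G x (arm b 2F)) (sym e) (Adj-sym G (edge₂₃ b)))))

  arm-injective : ∀ {a b i j} → arm a i ≡ arm b j → a ≡ b × i ≡ j
  arm-injective e with same-kind e
  ... | refl = injective-at _ e , refl

  neighbours : ∀ a i {v} → Adj G (arm a (suc i)) v → ∃[ j ] v ≡ arm a j × pathAdj (suc i) j ≡ true
  neighbours a 0F x with only₁ a x
  ... | inj₁ e = 0F , e , refl
  ... | inj₂ e = 2F , e , refl
  neighbours a 1F x with only₂ a x
  ... | inj₁ e = 1F , e , refl
  ... | inj₂ e = 3F , e , refl
  neighbours a 2F x = 2F , only₃ a x , refl

  arm-edge : ∀ a i j → pathAdj i j ≡ true → Adj G (arm a i) (arm a j)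
  arm-edge a 0F 1F _ = edge₀₁ a
  arm-edge a 1F 0F _ = Adj-sym G (edge₀₁ a)
  arm-edge a 1F 2F _ = edge₁₂ a
  arm-edge a 2F 1F _ = Adj-sym G (edge₁₂ a)
  arm-edge a 2F 3F _ = edge₂₃ a
  arm-edge a 3F 2F _ = Adj-sym G (edge₂₃ a)

  off-hub : ∀ {a b} i j → Adj G (arm a (suc i)) (arm b j) → a ≡ b × pathAdj (suc i) j ≡ true
  off-hub {a} i j x with neighbours a i x
  ... | _ , e , p with arm-injective e
  ...   | refl , refl = refl , p

  path-adj : ∀ {a b} i j → (Adj G (arm a i) (arm b j) → a ≡ b × pathAdj i j ≡ true) →
             adj G (arm a i) (arm b j) ≡ ⌊ a ≟ b ⌋ ∧ pathAdj i j
  path-adj {a} {b} i j forward = bool-ext to from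
    where
    to : Adj G (arm a i) (arm b j) → ⌊ a ≟ b ⌋ ∧ pathAdj i j ≡ true
    to x with forward x
    ... | a≡b , p = cong₂ _∧_ (trans (isYes≗does (a ≟ b)) (dec-true (a ≟ b) a≡b)) p
    from : ⌊ a ≟ b ⌋ ∧ pathAdj i j ≡ true → Adj G (arm a i) (arm b j)
    from p with a ≟ b
    ... | yes refl = arm-edge a i j p

  corona-adj : ∀ a i b j → adj G (arm a i) (arm b j) ≡ coronaAdj H (a , i) (b , j)
  corona-adj a 0F      b 0F      = refl
  corona-adj a 0F      b (suc j) = path-adj 0F (suc j) λ x →
    let b≡a , p = off-hub j 0F (Adj-sym G x) in sym b≡a , trans (pathAdj-sym 0F (suc j)) p
  corona-adj a (suc i) b j       = path-adj (suc i) j (off-hub i j)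

  -- Contract every arm to its hub: an edge between hubs becomes a step in `H`, and any other edge
  -- stays within one arm.
  project : ∀ {u v} → Reach G u v → ∀ {a b i j} → arm a i ≡ u → arm b j ≡ v → Reach H a b
  project here e f with arm-injective (trans e (sym f))
  ... | refl , _ = here
  project (step {w = w} x r) {a} {b} {i} e f with cover w
  ... | c , k , g = hop i k (subst₂ (Adj G) (sym e) (sym g) x) (project r g f)
    where
    hop : ∀ i k → Adj G (arm a i) (arm c k) → Reach H c b → Reach H a b
    hop 0F      0F      y r = step y r
    hop 0F      (suc k) y r with off-hub k 0F (Adj-sym G y)
    ... | refl , _ = r
    hop (suc i) k       y r with off-hub i k y
    ... | refl , _ = r

  hubGraph-tree : IsTree H
  hubGraph-tree = (λ a b → project (proj₁ tree (hub a) (hub b)) refl refl) , acyclic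
    where
    acyclic : Acyclic H
    acyclic x xs (len , uniq , linked) = proj₂ tree (hub x) (map hub xs)
      ( subst (2 ≤_) (sym (length-map hub xs)) len
      , Unique.map⁺ hub-injective uniq
      , subst (Linked (Adj G)) (cong (hub x ∷_) (map-++ hub xs (x ∷ []))) (Linked.map⁺ linked))

  place : Fin n → Fin hubs × Fin 4
  place v = let a , i , _ = cover v in a , i

  arm-place : ∀ v → arm (proj₁ (place v)) (proj₂ (place v)) ≡ v
  arm-place v = proj₂ (proj₂ (cover v))

  place-arm : ∀ a i → place (arm a i) ≡ (a , i)
  place-arm a i = let e , f = arm-injective (arm-place (arm a i)) in cong₂ _,_ e f

  is-corona : Is3CoronaOf G H
  is-corona = mk⤖ (injective , λ (a , i) → arm a i , λ where refl → place-arm a i) , λ u v →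
      trans (sym (cong₂ (adj G) (arm-place u) (arm-place v))) (corona-adj _ _ _ _)
    where
    injective : ∀ {u v} → place u ≡ place v → u ≡ v
    injective {u} {v} e = trans (sym (arm-place u))
      (trans (cong (λ (a , i) → arm a i) e) (arm-place v))

-- Pendant vertices and supports.

module _ (G : Graph n) where

  Pendant? : ∀ v → Dec (Pendant G v)
  Pendant? v = map′
    (λ (s , vs , only) → s , vs , λ {w} → only w)
    (λ (s , vs , only) → s , vs , λ w → only {w})
    (any? λ s → Adj? G v s ×-dec all? (λ w → Adj? G v w →-dec (w ≟ s)))

  Support : Fin n → Set
  Support v = ∃[ r ] Adj G v r × Pendant G r

  Support? : ∀ v → Dec (Support v)
  Support? v = any? λ r → Adj? G v r ×-dec Pendant? r

  pendant-neighbour : ∀ {r s t} → Pendant G r → Adj G r s → Adj G r t → s ≡ t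
  pendant-neighbour (_ , _ , only) rs rt = trans (only rs) (sym (only rt))

  second-neighbour : ∀ {v x} → ¬ Pendant G v → Adj G v x → ∃[ y ] Adj G v y × y ≢ x
  second-neighbour {v} {x} ¬pv vx with any? (λ y → Adj? G v y ×-dec ¬? (y ≟ x))
  ... | yes found = found
  ... | no  none  = contradiction
    (x , vx , λ {w} vw → decidable-stable (w ≟ x) λ w≢x → none (w , vw , w≢x)) ¬pv

module _ (G : Graph n) (twinFree : TwinFree G) where

  -- Two pendant vertices at the same support have equal open neighbourhoods.
  pendant-unique : ∀ {v r r′} → Adj G v r → Pendant G r → Adj G v r′ → Pendant G r′ → r ≡ r′
  pendant-unique {v} {r} {r′} vr pr vr′ pr′ with r ≟ r′
  ... | yes e = e
  ... | no r≢r′ = contradiction (tabulate-cong λ w → bool-ext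
    (λ rw  → subst (Adj G r′) (pendant-neighbour G pr (Adj-sym G vr) rw) (Adj-sym G vr′))
    (λ r′w → subst (Adj G r) (pendant-neighbour G pr′ (Adj-sym G vr′) r′w) (Adj-sym G vr)))
    (proj₁ (twinFree r r′ r≢r′))

  -- Two adjacent pendant vertices have equal closed neighbourhoods.
  support-¬pendant : ∀ {v} → Support G v → ¬ Pendant G v
  support-¬pendant {v} (r , vr , pr) pv =
    proj₂ (twinFree v r (Adj⇒≢ G vr)) (tabulate-cong same)
    where
    same : ∀ w → ⌊ w ≟ v ⌋ ∨ adj G v w ≡ ⌊ w ≟ r ⌋ ∨ adj G r w
    same w with w ≟ v | w ≟ r
    ... | yes refl | yes refl = refl
    ... | yes refl | no _     = sym (Adj-sym G vr)
    ... | no _     | yes refl = vr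
    ... | no w≢v   | no w≢r   = bool-ext
      (λ vw → contradiction (pendant-neighbour G pv vw vr) w≢r)
      (λ rw → contradiction (pendant-neighbour G pr rw (Adj-sym G vr)) w≢v)

-- Decomposing the tree into arms.

module _ {G : Graph n} (tree : IsTree G) (twinFree : TwinFree G)
         {k} (minimum : ∀ C → IsTDIDCode G C → k ≤ ∣ C ∣) (4k≡3n : 4 * k ≡ 3 * n)
         (neighbour : ∀ v → ∃[ w ] Adj G v w) where

  private
    S : Fin n → Set
    S = Support G

  -- When no two supports are adjacent, hubs, third vertices, supports and pendant vertices are the
  -- positions 0F to 3F of the arms.
  Third : Fin n → Set
  Third v = ¬ Pendant G v × ¬ S v × ∃[ c ] Adj G v c × S c

  Hub : Fin n → Set
  Hub v = ¬ Pendant G v × ¬ S v × ¬ (∃[ c ] Adj G v c × S c)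

  abstract

    -- Twin-freeness allows a support a single leaf, and `support-degree` a single further
    -- neighbour.
    support-neighbours : ∀ {s r} → Adj G s r → Pendant G r →
      ∃[ t ] Adj G s t × t ≢ r × ¬ Pendant G t × (∀ {v} → Adj G s v → v ≡ t ⊎ v ≡ r)
    support-neighbours {s} {r} sr pr
      with second-neighbour G (support-¬pendant G twinFree (r , sr , pr)) sr
    ... | t , st , t≢r = t , st , t≢r , ¬pendant st t≢r , λ {v} sv → cases v sv
      where
      ¬pendant : ∀ {v} → Adj G s v → v ≢ r → ¬ Pendant G v
      ¬pendant sv v≢r pv = v≢r (pendant-unique G twinFree sv pv sr pr)
      cases : ∀ v → Adj G s v → v ≡ t ⊎ v ≡ r
      cases v sv with v ≟ t | v ≟ r
      ... | yes e  | _      = inj₁ e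
      ... | _      | yes e  = inj₂ e
      ... | no v≢t | no v≢r = contradiction (¬pendant st t≢r)
        (support-degree tree twinFree minimum 4k≡3n sr pr v≢t sv (¬pendant sv v≢r) st)

  module FourVertices {c w} (cw : Adj G c w) (sc : S c) (sw : S w) where

    private
      r z : Fin n
      r = proj₁ sc
      z = proj₁ sw

      cr : Adj G c r
      cr = proj₁ (proj₂ sc)
      wz : Adj G w z
      wz = proj₁ (proj₂ sw)
      pr : Pendant G r
      pr = proj₂ (proj₂ sc)
      pz : Pendant G z
      pz = proj₂ (proj₂ sw)

      support-≢ : ∀ {x y} → S x → Pendant G y → x ≢ y
      support-≢ sx py refl = support-¬pendant G twinFree sx py

      only-two : ∀ {x y u v} → Adj G x y → Pendant G y → S u → Adj G x u → Adj G x v → v ≡ u ⊎ v ≡ y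
      only-two xy py su xu xv with support-neighbours xy py
      ... | _ , _ , _ , _ , cases with cases xu | cases xv
      ...   | inj₂ refl | _      = contradiction py (support-¬pendant G twinFree su)
      ...   | inj₁ refl | either = either

      z≢r : z ≢ r
      z≢r refl = Adj⇒≢ G cw (pendant-neighbour G pr (Adj-sym G cr) (Adj-sym G wz))

      -- This path has a leaf at both ends; the end `z` is taken as the hub, so `H` is a single
      -- vertex.
      arm : Fin 4 → Fin n
      arm 0F = z
      arm 1F = w
      arm 2F = c
      arm 3F = r

      kind : Fin n → Fin 4
      kind v with v ≟ z | v ≟ w | v ≟ c
      ... | yes _ | _     | _     = 0F
      ... | no _  | yes _ | _     = 1F
      ... | no _  | no _  | yes _ = 2F
      ... | no _  | no _  | no _  = 3F

      kind-arm : ∀ i → kind (arm i) ≡ i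
      kind-arm 0F with z ≟ z
      ... | yes _ = refl
      ... | no z≢z = contradiction refl z≢z
      kind-arm 1F with w ≟ z | w ≟ w
      ... | yes e | _     = contradiction e (support-≢ sw pz)
      ... | no _  | yes _ = refl
      ... | no _  | no w≢w = contradiction refl w≢w
      kind-arm 2F with c ≟ z | c ≟ w | c ≟ c
      ... | yes e | _     | _      = contradiction e (support-≢ sc pz)
      ... | no _  | yes e | _      = contradiction e (Adj⇒≢ G cw)
      ... | no _  | no _  | yes _  = refl
      ... | no _  | no _  | no c≢c = contradiction refl c≢c
      kind-arm 3F with r ≟ z | r ≟ w | r ≟ c
      ... | yes e | _     | _     = contradiction (sym e) z≢r
      ... | no _  | yes e | _     = contradiction (sym e) (support-≢ sw pr)
      ... | no _  | no _  | yes e = contradiction (sym e) (support-≢ sc pr)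
      ... | no _  | no _  | no _  = refl

      one-hub : ∀ (a b : Fin 1) → a ≡ b
      one-hub 0F 0F = refl

      -- Each of the two supports is adjacent only to its leaf and to the other support. As no edge
      -- leaves the path, connectivity makes it the whole tree.
      closed : ∀ i {v} → Adj G (arm i) v → ∃[ j ] arm j ≡ v
      closed 0F zv = 1F , pendant-neighbour G pz (Adj-sym G wz) zv
      closed 1F wv with only-two wz pz sc (Adj-sym G cw) wv
      ... | inj₁ e = 2F , sym e
      ... | inj₂ e = 0F , sym e
      closed 2F cv with only-two cr pr sw cw cv
      ... | inj₁ e = 1F , sym e
      ... | inj₂ e = 3F , sym e
      closed 3F rv = 2F , pendant-neighbour G pr (Adj-sym G cr) rv

      reachable : ∀ {u v} → Reach G u v → ∀ i → arm i ≡ u → ∃[ j ] arm j ≡ v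
      reachable here       i e    = i , e
      reachable (step a p) i refl = let j , e = closed i a in reachable p j e

    four-vertices : CoronaStructure G
    four-vertices = record
      { hubs          = 1
      ; arm           = λ _ → arm
      ; kind          = kind
      ; kind-arm      = λ _ → kind-arm
      ; hub-injective = λ {a} {b} _ → one-hub a b
      ; cover         = λ v → 0F , reachable (proj₁ tree z v) 0F refl
      ; edge₀₁        = λ _ → Adj-sym G wz
      ; edge₁₂        = λ _ → Adj-sym G cw
      ; edge₂₃        = λ _ → cr
      ; only₁         = λ _ wv → [ inj₂ , inj₁ ]′ (only-two wz pz sc (Adj-sym G cw) wv)
      ; only₂         = λ _ cv → only-two cr pr sw cw cv
      ; only₃         = λ _ rv → pendant-neighbour G pr rv (Adj-sym G cr)
      }

  module ManyVertices (separated : ∀ {c w} → Adj G c w → S c → ¬ S w) where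

    record Limb (t c r : Fin n) : Set where
      field
        third   : Third t
        support : S c
        pendant : Pendant G r
        tc      : Adj G t c
        cr      : Adj G c r
        only-c  : ∀ {v} → Adj G c v → v ≡ t ⊎ v ≡ r

    record Path (h t c r : Fin n) : Set where
      field
        limb   : Limb t c r
        is-hub : Hub h
        ht     : Adj G h t
        only-t : ∀ {v} → Adj G t v → v ≡ h ⊎ v ≡ c
      open Limb limb public

    abstract

      limb-at : ∀ {c r} → Adj G c r → Pendant G r → ∃[ t ] Limb t c r
      limb-at {c} {r} cr pr with support-neighbours cr pr
      ... | t , ct , t≢r , ¬pt , cases = t , record
        { third   = ¬pt , separated ct (r , cr , pr) , c , Adj-sym G ct , r , cr , pr
        ; support = r , cr , pr
        ; pendant = pr
        ; tc      = Adj-sym G ct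
        ; cr      = cr
        ; only-c  = cases
        }

      -- Seen from `t`, the leaf `r` is at distance two. Hence no neighbour of `t` besides `c` has a
      -- leaf at most two steps beyond it, which makes `h` a hub, and `t` has no second such
      -- neighbour, as none of them is pendant.
      path-at : ∀ {t c r} → Limb t c r → ∃[ h ] Path h t c r
      path-at {t} {c} {r} L with second-neighbour G (proj₁ (Limb.third L)) (Limb.tc L)
      ... | h , th , h≢c = h , record
        { limb   = L
        ; is-hub = ¬p th , (λ sh → beside h≢c th (inj₁ (leaf-beyond sh)))
                         , (λ (c′ , hc′ , sc′) → beside h≢c th
                             (inj₂ (c′ , hc′ , (λ where refl → ¬st sc′) , leaf-past (¬p th) sc′)))
        ; ht     = Adj-sym G th
        ; only-t = λ {v} → cases v
        }
        where
        open Limb L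
        ¬st : ¬ S t
        ¬st = proj₁ (proj₂ third)
        ¬p : ∀ {v} → Adj G t v → ¬ Pendant G v
        ¬p tv pv = ¬st (_ , tv , pv)
        leaf-past : ∀ {x y} → ¬ Pendant G x → S y → LeafBeyond G x y
        leaf-past ¬px (r , yr , pr) = r , yr , (λ where refl → ¬px pr) , pr
        leaf-beyond : ∀ {y} → S y → LeafBeyond G t y
        leaf-beyond = leaf-past (proj₁ third)
        beside : ∀ {v} → v ≢ c → Adj G t v → ¬ NearBeyond G t v
        beside v≢c tv = not-near-beside tree twinFree minimum 4k≡3n
          tc (leaf-beyond support) tv (≢-sym v≢c)
        cases : ∀ v → Adj G t v → v ≡ h ⊎ v ≡ c
        cases v tv with v ≟ h | v ≟ c
        ... | yes e  | _      = inj₁ e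
        ... | _      | yes e  = inj₂ e
        ... | no v≢h | no v≢c = contradiction (¬p th)
          (no-two-inner-beside tree twinFree minimum 4k≡3n tc (leaf-beyond support)
            v≢h (≢-sym v≢c) (≢-sym h≢c) tv (¬p tv) th)

      third-limb : ∀ {t} → Third t → ∃[ c ] ∃[ r ] Limb t c r
      third-limb {t} T@(¬pt , _ , c , tc , r , cr , pr) with limb-at cr pr
      ... | t′ , L with Limb.only-c L (Adj-sym G tc)
      ...   | inj₁ refl = c , r , L
      ...   | inj₂ refl = contradiction pr ¬pt

      -- Without a third vertex next to it, `h` would have two neighbours and no leaf within
      -- distance three. The search is decidable, so the double negation can be removed.
      third-neighbour : ∀ {h} → Hub h → ∃[ t ] Adj G h t × Third t
      third-neighbour {h} (¬ph , ¬sh , ¬ssh) = decidable-stable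
        (any? λ t → Adj? G h t ×-dec
          (¬? (Pendant? G t) ×-dec (¬? (Support? G t) ×-dec
            any? λ c → Adj? G t c ×-dec Support? G c)))
        λ none → let x , hx = neighbour h ; y , hy , y≢x = second-neighbour G ¬ph hx in
          leaf-within-three tree twinFree minimum 4k≡3n y≢x hy hx λ {w} hw →
            (λ pw → ¬sh (w , hw , pw)) , λ where
              (inj₁ (r , wr , _ , pr)) → ¬ssh (w , hw , r , wr , pr)
              (inj₂ (s , ws , _ , r , sr , _ , pr)) →
                none (w , hw , (λ pw → ¬sh (w , hw , pw)) , (λ sw → ¬ssh (w , hw , sw))
                        , s , ws , r , sr , pr)

      path-of-third : ∀ {h t c r} → Hub h → Adj G h t → Limb t c r → (∃[ h′ ] Path h′ t c r) →
                      Path h t c r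
      path-of-third hubh ht L (h′ , P) with Path.only-t P (Adj-sym G ht)
      ... | inj₁ refl = P
      ... | inj₂ refl = contradiction (Limb.support L) (proj₁ (proj₂ hubh))

      hub-path : ∀ {h} → Hub h → ∃[ t ] ∃[ c ] ∃[ r ] Path h t c r
      hub-path {h} hubh = from (third-neighbour hubh)
        where
        along : ∀ {t} → Adj G h t → (∃[ c ] ∃[ r ] Limb t c r) → ∃[ t ] ∃[ c ] ∃[ r ] Path h t c r
        along ht (c , r , L) = _ , c , r , path-of-third hubh ht L (path-at L)
        from : (∃[ t ] Adj G h t × Third t) → ∃[ t ] ∃[ c ] ∃[ r ] Path h t c r
        from (t , ht , T) = along ht (third-limb T)

    path-pendantPath : ∀ {h t c r} → Path h t c r →
                       PendantPath tree twinFree minimum 4k≡3n h t c r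
    path-pendantPath P = record
      { ρw  = ht
      ; wc  = tc
      ; c≢ρ = λ where refl → proj₁ (proj₂ is-hub) support
      ; cr  = cr
      ; r≢w = λ where refl → proj₁ third pendant
      ; pr  = pendant
      }
      where open Path P

    -- The leaf at distance three from the hub is unique, and following the arm inwards from the
    -- leaf determines the rest.
    path-unique : ∀ {h t c r t′ c′ r′} → Path h t c r → Path h t′ c′ r′ →
                  t ≡ t′ × c ≡ c′ × r ≡ r′
    path-unique P P′
      with pendantPath-unique tree twinFree minimum 4k≡3n (path-pendantPath P) (path-pendantPath P′)
    ... | refl with pendant-neighbour G (Path.pendant P)
                      (Adj-sym G (Path.cr P)) (Adj-sym G (Path.cr P′))
    ...   | refl with Path.only-c P (Adj-sym G (Path.tc P′))
    ...     | inj₁ refl = refl , refl , refl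
    ...     | inj₂ refl = contradiction (Path.pendant P) (proj₁ (Path.third P′))

    HasSupport? : ∀ v → Dec (∃[ c ] Adj G v c × S c)
    HasSupport? v = any? λ c → Adj? G v c ×-dec Support? G c

    kind : Fin n → Fin 4
    kind v with Pendant? G v | Support? G v | HasSupport? v
    ... | yes _ | _     | _     = 3F
    ... | no _  | yes _ | _     = 2F
    ... | no _  | no _  | yes _ = 1F
    ... | no _  | no _  | no _  = 0F

    kind-pendant : ∀ {v} → Pendant G v → kind v ≡ 3F
    kind-pendant {v} p with Pendant? G v
    ... | yes _ = refl
    ... | no ¬p = contradiction p ¬p

    kind-support : ∀ {v} → S v → kind v ≡ 2F
    kind-support {v} s with Pendant? G v | Support? G v
    ... | yes p | _     = contradiction p (support-¬pendant G twinFree s)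
    ... | no _  | yes _ = refl
    ... | no _  | no ¬s = contradiction s ¬s

    kind-third : ∀ {v} → Third v → kind v ≡ 1F
    kind-third {v} (¬p , ¬s , x) with Pendant? G v | Support? G v | HasSupport? v
    ... | yes p | _     | _     = contradiction p ¬p
    ... | no _  | yes s | _     = contradiction s ¬s
    ... | no _  | no _  | yes _ = refl
    ... | no _  | no _  | no ¬x = contradiction x ¬x

    kind-hub : ∀ {v} → Hub v → kind v ≡ 0F
    kind-hub {v} (¬p , ¬s , ¬x) with Pendant? G v | Support? G v | HasSupport? v
    ... | yes p | _     | _     = contradiction p ¬p
    ... | no _  | yes s | _     = contradiction s ¬s
    ... | no _  | no _  | yes x = contradiction x ¬x
    ... | no _  | no _  | no _  = refl

    hubs : Enumeration Hub
    hubs = enumerate λ v →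
      ¬? (Pendant? G v) ×-dec (¬? (Support? G v) ×-dec ¬? (HasSupport? v))

    open Enumeration hubs

    module Along (a : Fin size) where
      t c r : Fin n
      t = proj₁ (hub-path (sound a))
      c = proj₁ (proj₂ (hub-path (sound a)))
      r = proj₁ (proj₂ (proj₂ (hub-path (sound a))))
      path : Path (elem a) t c r
      path = proj₂ (proj₂ (proj₂ (hub-path (sound a))))
      open Path path public

    arm : Fin size → Fin 4 → Fin n
    arm a 0F = elem a
    arm a 1F = Along.t a
    arm a 2F = Along.c a
    arm a 3F = Along.r a

    kind-arm : ∀ a i → kind (arm a i) ≡ i
    kind-arm a 0F = kind-hub (sound a)
    kind-arm a 1F = kind-third (Along.third a)
    kind-arm a 2F = kind-support (Along.support a)
    kind-arm a 3F = kind-pendant (Along.pendant a)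

    -- By uniqueness the arm chosen for a hub is any path starting there, so an arm completed from
    -- one of its outer vertices is among the enumerated ones.
    path-cover : ∀ {h t c r} → Path h t c r →
      ∃[ a ] arm a 0F ≡ h × arm a 1F ≡ t × arm a 2F ≡ c × arm a 3F ≡ r
    path-cover P with index (Path.is-hub P)
    ... | a , refl = a , refl , path-unique (Along.path a) P

    cover : ∀ v → ∃[ a ] ∃[ i ] arm a i ≡ v
    cover v with Pendant? G v | Support? G v | HasSupport? v
    ... | yes p@(s , vs , _) | _ | _ =
      let _ , L = limb-at (Adj-sym G vs) p ; _ , P = path-at L
          a , _ , _ , _ , e = path-cover P
      in a , 3F , e
    ... | no _ | yes (r , vr , pr) | _ =
      let _ , L = limb-at vr pr ; _ , P = path-at L
          a , _ , _ , e , _ = path-cover P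
      in a , 2F , e
    ... | no ¬p | no ¬s | yes x =
      let _ , _ , L = third-limb (¬p , ¬s , x) ; _ , P = path-at L
          a , _ , e , _ = path-cover P
      in a , 1F , e
    ... | no ¬p | no ¬s | no ¬x = let a , e = index (¬p , ¬s , ¬x) in a , 0F , e

    many-vertices : CoronaStructure G
    many-vertices = record
      { hubs          = size
      ; arm           = arm
      ; kind          = kind
      ; kind-arm      = kind-arm
      ; hub-injective = injective
      ; cover         = cover
      ; edge₀₁        = Along.ht
      ; edge₁₂        = Along.tc
      ; edge₂₃        = Along.cr
      ; only₁         = λ a → Along.only-t a
      ; only₂         = λ a → Along.only-c a
      ; only₃         = λ a rv → pendant-neighbour G (Along.pendant a) rv (Adj-sym G (Along.cr a))
      }

  corona-structure : CoronaStructure G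
  corona-structure with any? (λ c → any? (λ w → Adj? G c w ×-dec
                                 (Support? G c ×-dec Support? G w)))
  ... | yes (_ , _ , cw , sc , sw) = FourVertices.four-vertices cw sc sw
  ... | no none = ManyVertices.many-vertices λ cw sc sw → none (_ , _ , cw , sc , sw)

theorem16 : (n : ℕ) (T : Graph n) → IsTree T → TwinFree T → 4 ≤ n
    → (k : ℕ) → γtID≡ T k → 4 * k ≡ 3 * n
    → Σ ℕ λ m → Σ (Graph m) λ H → IsTree H × Is3CoronaOf T H
theorem16 n T tree twinFree _ k ((_ , (_ , dominating) , _) , minimum) 4k≡3n =
  _ , hubGraph tree structure , hubGraph-tree tree structure , is-corona tree structure
  where
  structure : CoronaStructure T
  structure = corona-structure tree twinFree minimum 4k≡3n
    -- Total domination by the given code shows that no vertex is isolated.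
    λ v → let w , vw , _ = dominating v in w , vw
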